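{- For each partition $\lambda$, $$D^{2r+1}\Bigl(\frac{L_r(\lambda)}{H_\lambda}\Bigr)=0\quad(r\ge0),\qquad D^{2r}\Bigl(\frac{L_r(\lambda)}{H_\lambda}\Bigr)=\frac{(2r-1)!!}{H_\lambda}\quad(r\ge1),\qquad D^{2r-1}\Bigl(\frac{L_r(\lambda)}{H_\lambda}\Bigr)=\frac{(2r-1)!!}{H_\lambda}|\lambda|\quad(r\ge1).$$
   Context: $h_\square$ is the hook length of a box of the Young diagram (arm + leg + 1), $H_\lambda=\prod_{\square\in\lambda}h_\square$, $H_\emptyset=1$. For a positive integer $h$, let $\rho(h,z)$ be the formal power series in $z$ $$\rho(h,z)=\frac{h\sum_{k\ge0}\binom{h}{2k}z^k}{\sum_{k\ge0}\binom{h}{2k+1}z^k}\ \Bigl(=\frac{(1+\sqrt z)^h+(1-\sqrt z)^h}{(1+\sqrt z)^h-(1-\sqrt z)^h}\,h\sqrt z\Bigr)=1+\frac{h^2-1}{3}z+\cdots,$$ and define $L_k(\lambda)$ by $\prod_{\square\in\lambda}\rho(h_\square,z)=\sum_{k\ge0}L_k(\lambda)z^k$. For a function $g$ on partitions, $Dg(\lambda)=\sum_{\lambda^+}g(\lambda^+)-g(\lambda)$, where $\lambda^+$ ranges over partitions obtained from $\lambda$ by adding one box; $D^0g=g$, $D^kg=D(D^{k-1}g)$. -}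

module Defs where

open import Data.Nat as ℕ using (ℕ; zero; suc; _<ᵇ_; _<_; _≥_)
open import Data.Nat.Combinatorics using (_C_)
open import Data.Bool using (Bool; true; false; if_then_else_)
open import Data.Maybe using (Maybe; just; nothing)
open import Data.List using (List; []; _∷_; _++_; map; concat; length; filter; zipWith; upTo; foldr; applyUpTo)
open import Data.List.Relation.Unary.All using (All)
open import Data.List.Relation.Unary.Linked using (Linked)
open import Data.Integer using (+_)
open import Data.Product using (_×_)
open import Data.Rational using (ℚ; 0ℚ; 1ℚ; _+_; _*_; _-_; _/_)

ℕ→ℚ : ℕ → ℚ
ℕ→ℚ n = (+ n) / 1

-- 1/n for n ≥ 1 (the value at 0 is never used: hook products are positive)
inv : ℕ → ℚ
inv zero = 0ℚ
inv (suc n) = (+ 1) / suc n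

sumℚ : List ℚ → ℚ
sumℚ = foldr _+_ 0ℚ

productℕ : List ℕ → ℕ
productℕ = foldr ℕ._*_ 1

IsPartition : List ℕ → Set
IsPartition λ′ = Linked _≥_ λ′ × All (0 <_) λ′

size : List ℕ → ℕ
size = foldr ℕ._+_ 0

column : List ℕ → ℕ → ℕ
column λ′ j = length (filter (λ x → j ℕ.<? x) λ′)

-- hook lengths of all boxes (i , j), 0-indexed: (λ_i - j - 1) + (λ'_j - i - 1) + 1
hooksFrom : ℕ → List ℕ → List ℕ → List ℕ
hooksFrom i full [] = []
hooksFrom i full (x ∷ xs) =
  applyUpTo (λ j → suc ((x ℕ.∸ suc j) ℕ.+ (column full j ℕ.∸ suc i))) x
  ++ hooksFrom (suc i) full xs

hooks : List ℕ → List ℕ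
hooks λ′ = hooksFrom 0 λ′ λ′

H : List ℕ → ℕ
H λ′ = productℕ (hooks λ′)

Series : Set
Series = ℕ → ℚ

oneS : Series
oneS zero = 1ℚ
oneS (suc _) = 0ℚ

_⊛_ : Series → Series → Series
(f ⊛ g) n = sumℚ (map (λ i → f i * g (n ℕ.∸ i)) (upTo (suc n)))

-- ρ(h,z) = A(z) / (B(z)/h), with A_k = C(h,2k), B_k = C(h,2k+1) (B_0 = h).
-- Coefficients c_k determined by  B·c = h·A, i.e.
--   c_k = A_k - (1/h) Σ_{j=1}^{k} B_j c_{k-j}.
-- rhoRev h k = [c_k , c_{k-1} , … , c_0]
rhoStep : ℕ → ℕ → List ℚ → ℚ
rhoStep h k prev =
  ℕ→ℚ (h C (2 ℕ.* k))
  - inv h * sumℚ (zipWith (λ j c → ℕ→ℚ (h C suc (2 ℕ.* j)) * c)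
                          (applyUpTo suc k) prev)

rhoRev : ℕ → ℕ → List ℚ
rhoRev h zero = rhoStep h 0 [] ∷ []
rhoRev h (suc k) = rhoStep h (suc k) (rhoRev h k) ∷ rhoRev h k

headℚ : List ℚ → ℚ
headℚ [] = 0ℚ
headℚ (x ∷ _) = x

ρ : ℕ → Series
ρ h k = headℚ (rhoRev h k)

L : ℕ → List ℕ → ℚ
L k λ′ = foldr (λ h s → ρ h ⊛ s) oneS (hooks λ′) k

canInc : Maybe ℕ → ℕ → Bool
canInc nothing x = true
canInc (just p) x = x <ᵇ p

upsFrom : Maybe ℕ → List ℕ → List (List ℕ)
upsFrom prev [] = (1 ∷ []) ∷ []
upsFrom prev (x ∷ xs) =
  (if canInc prev x then (suc x ∷ xs) ∷ [] else [])
  ++ map (x ∷_) (upsFrom (just x) xs)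

ups : List ℕ → List (List ℕ)
ups = upsFrom nothing

D : (List ℕ → ℚ) → (List ℕ → ℚ)
D g λ′ = sumℚ (map g (ups λ′)) - g λ′

Dpow : ℕ → (List ℕ → ℚ) → (List ℕ → ℚ)
Dpow zero g = g
Dpow (suc k) g = D (Dpow k g)

oddFact : ℕ → ℕ
oddFact zero = 1
oddFact (suc r) = suc (2 ℕ.* r) ℕ.* oddFact r

F : ℕ → List ℕ → ℚ
F r λ′ = L r λ′ * inv (H λ′)

{-# OPTIONS --safe #-}

-- Let W(h) = ρ(h,z)/h = √z coth (hθ) with tanh θ = √z, F_r(λ) = L_r(λ)/H_λ and
-- G(λ) = Σ_r F_r(λ) z^r = ∏_□ W(h_□).  In terms of the first-column hook
-- lengths b_i, G(λ) = ∏_i W(1)⋯W(b_i) / ∏_{i<j} W(b_i - b_j), so the ratios of G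
-- between neighbouring partitions are products of values of W.  The addition
-- theorem of coth yields a partial fraction expansion of such products, and its
-- sum of residues reads D G = z d G, where d g(λ) = Σ_{λ⁻} g(λ⁻) over the
-- partitions with one box removed; that is, D F_0 = 0 and D F_{r+1} = d F_r.
-- Since D d = d D + 1,
--   D^{2r+1} F_{r+1} = D^{2r} d F_r = d D^{2r} F_r + 2r D^{2r-1} F_r,
-- whence D^{2r-1} F_r = (2r-1)!! d F_0 by induction.  A residue sum at z = 0
-- gives d F_0 = |λ| F_0, and D d F_0 = F_0 gives the remaining claims.
module Submission where

open import Defs
open import Algebra.Bundles using (CommutativeRing)
import Algebra.Construct.Pointwise as Pointwise
import Algebra.Solver.Ring as RingSolver
open import Algebra.Solver.Ring.AlmostCommutativeRing using (fromCommutativeRing; _-Raw-AlmostCommutative⟶_)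
open import Data.Bool using (Bool; true; false; if_then_else_; T)
open import Data.Empty using (⊥-elim)
open import Data.Integer as ℤ using (ℤ; -[1+_]; _⊖_)
import Data.Integer.Properties as ℤ
open import Data.List using (List; []; _∷_; _++_; length; map; foldr; zipWith; applyUpTo)
import Data.List.Properties as List
open import Data.List.Relation.Unary.All as All using (All; []; _∷_)
open import Data.List.Relation.Unary.AllPairs using (AllPairs; []; _∷_)
open import Data.List.Relation.Unary.Linked using (Linked; [-]; _∷_)
open import Data.Maybe as Maybe using (Maybe; just; nothing)
open import Data.Nat as ℕ using (ℕ; zero; suc; pred; _∸_; _<_; _≤_; s≤s; z≤n; _<ᵇ_)
open import Data.Nat.Combinatorics using (_C_; nCk+nC[k+1]≡[n+1]C[k+1]; nC1≡n; nCn≡1; nCk≡nC[n∸k]; k>n⇒nCk≡0)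
import Data.Nat.Properties as ℕ
open import Data.Product using (_×_; _,_)
open import Data.Rational as ℚ using (ℚ; 0ℚ; 1ℚ; toℚᵘ)
import Data.Rational.Properties as ℚ
open import Data.Rational.Unnormalised as ℚᵘ using (mkℚᵘ; *≡*)
import Data.Rational.Unnormalised.Properties as ℚᵘ
open import Data.Sum using (inj₁; inj₂)
open import Data.Unit using (⊤; tt)
open import Function using (_∘_; id)
open import Level using (0ℓ; _⊔_)
open import Relation.Binary.PropositionalEquality as ≡ using (_≡_; _≢_; module ≡-Reasoning)
open import Relation.Nullary.Decidable using (dec⇒maybe)

-- Partial fractions apply to products of coth, whereas the ratios of G between neighbours also
-- contain values of tanh. Since √z tanh is √z coth shifted by half a period, z times each such
-- value is again a kernel, and n first-column hook lengths lead to 2n+1 points. The surplus power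
-- of z must be divided out although z is no unit among power series, so the argument works with
-- non-zero-divisors. At z = 0 the resulting identity says nothing about d, which is why d F_0 needs
-- a rational kernel of its own. √z itself never occurs: (1 + √z)^n is carried as its even and odd
-- parts.
--
-- The other obstacle is the admissibility of corners. The hook product, written in first-column
-- hook lengths, extends to all lists of row lengths: it vanishes when a row exceeds the one above
-- by one box, because two first-column hook lengths then agree, and it ignores an empty last row.
-- Sums over corners thereby become unrestricted sums over rows.

-- A ring solver with integer coefficients over any commutative ring.

module IntegerCoefficients {c ℓ} (R : CommutativeRing c ℓ) where
  open CommutativeRing R
  open import Data.Integer using (+_)
  open import Algebra.Properties.Ring ring
  open import Algebra.Properties.Group +-group using (⁻¹-involutive; ε⁻¹≈ε)
  open import Algebra.Properties.AbelianGroup +-abelianGroup using (⁻¹-∙-comm)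
  open import Algebra.Properties.Semiring.Mult.TCOptimised semiring renaming (_×_ to _⋆_)
  open import Relation.Binary.Reasoning.Setoid setoid

  ⟦_⟧ℤ : ℤ → Carrier
  ⟦ + n ⟧ℤ = n ⋆ 1#
  ⟦ -[1+ n ] ⟧ℤ = - (suc n ⋆ 1#)

  ⊖-homo : ∀ m n → ⟦ m ⊖ n ⟧ℤ ≈ m ⋆ 1# - n ⋆ 1#
  ⊖-homo m zero = sym (trans (+-congˡ ε⁻¹≈ε) (+-identityʳ _))
  ⊖-homo zero (suc n) = sym (+-identityˡ _)
  ⊖-homo (suc m) (suc n) rewrite ℤ.[1+m]⊖[1+n]≡m⊖n m n = begin
    ⟦ m ⊖ n ⟧ℤ                                 ≈⟨ ⊖-homo m n ⟩
    m ⋆ 1# - n ⋆ 1#                            ≈⟨ +-congʳ (+-identityˡ _) ⟨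
    (0# + m ⋆ 1#) - n ⋆ 1#                     ≈⟨ +-congʳ (+-congʳ (-‿inverseʳ 1#)) ⟨
    ((1# - 1#) + m ⋆ 1#) - n ⋆ 1#              ≈⟨ +-congʳ (trans (+-assoc _ _ _) (trans (+-congˡ (+-comm _ _)) (sym (+-assoc _ _ _)))) ⟩
    ((1# + m ⋆ 1#) - 1#) - n ⋆ 1#              ≈⟨ +-assoc _ _ _ ⟩
    (1# + m ⋆ 1#) + (- 1# - n ⋆ 1#)            ≈⟨ +-congˡ (⁻¹-∙-comm _ _) ⟩
    (1# + m ⋆ 1#) - (1# + n ⋆ 1#)              ≈⟨ +-cong (1+× m 1#) (-‿cong (1+× n 1#)) ⟨
    suc m ⋆ 1# - suc n ⋆ 1#                    ∎

  -ℤ-homo : ∀ i → ⟦ ℤ.- i ⟧ℤ ≈ - ⟦ i ⟧ℤ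
  -ℤ-homo (+ zero) = sym ε⁻¹≈ε
  -ℤ-homo (+ suc n) = refl
  -ℤ-homo -[1+ n ] = sym (⁻¹-involutive _)

  +ℤ-homo : ∀ i j → ⟦ i ℤ.+ j ⟧ℤ ≈ ⟦ i ⟧ℤ + ⟦ j ⟧ℤ
  +ℤ-homo (+ m) (+ n) = ×-homo-+ 1# m n
  +ℤ-homo (+ m) -[1+ n ] = ⊖-homo m (suc n)
  +ℤ-homo -[1+ m ] (+ n) = trans (⊖-homo n (suc m)) (+-comm _ _)
  +ℤ-homo -[1+ m ] -[1+ n ] = begin
    - (suc (suc (m ℕ.+ n)) ⋆ 1#)   ≡⟨ ≡.cong (λ k → - (suc k ⋆ 1#)) (ℕ.+-suc m n) ⟨
    - ((suc m ℕ.+ suc n) ⋆ 1#)     ≈⟨ -‿cong (×-homo-+ 1# (suc m) (suc n)) ⟩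
    - (suc m ⋆ 1# + suc n ⋆ 1#)    ≈⟨ ⁻¹-∙-comm _ _ ⟨
    - (suc m ⋆ 1#) - suc n ⋆ 1#    ∎

  *ℤ-homo-pos : ∀ m j → ⟦ + m ℤ.* j ⟧ℤ ≈ m ⋆ 1# * ⟦ j ⟧ℤ
  *ℤ-homo-pos m (+ n) rewrite ≡.sym (ℤ.pos-* m n) = ×1-homo-* m n
  *ℤ-homo-pos m -[1+ n ] rewrite ≡.sym (ℤ.neg-distribʳ-* (+ m) (+ suc n)) | ≡.sym (ℤ.pos-* m (suc n)) =
    trans (-ℤ-homo (+ (m ℕ.* suc n))) (trans (-‿cong (×1-homo-* m (suc n))) (-‿distribʳ-* _ _))

  *ℤ-homo : ∀ i j → ⟦ i ℤ.* j ⟧ℤ ≈ ⟦ i ⟧ℤ * ⟦ j ⟧ℤ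
  *ℤ-homo (+ m) j = *ℤ-homo-pos m j
  *ℤ-homo -[1+ m ] j rewrite ≡.sym (ℤ.neg-distribˡ-* (+ suc m) j) =
    trans (-ℤ-homo (+ suc m ℤ.* j)) (trans (-‿cong (*ℤ-homo-pos (suc m) j)) (-‿distribˡ-* _ _))

  -- Coefficients are compared in ℤ, where equality is decidable; in the ring itself, for instance
  -- of power series, it need not be.
  morphism : ℤ.+-*-rawRing -Raw-AlmostCommutative⟶ fromCommutativeRing R
  morphism = record
    { ⟦_⟧ = ⟦_⟧ℤ
    ; +-homo = +ℤ-homo
    ; *-homo = *ℤ-homo
    ; -‿homo = -ℤ-homo
    ; 0-homo = refl
    ; 1-homo = refl
    }

  open RingSolver ℤ.+-*-rawRing (fromCommutativeRing R) morphism
    (λ i j → Maybe.map (λ e → reflexive (≡.cong ⟦_⟧ℤ e)) (dec⇒maybe (i ℤ.≟ j))) public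
    using (Polynomial; solve; _:=_; _:+_; _:*_; _:-_; :-_; con)

  :0 :1 : ∀ {n} → Polynomial n
  :0 = con (+ 0)
  :1 = con (+ 1)

-- Finite products, residue sums and partial fractions.

module Products {c ℓ} (R : CommutativeRing c ℓ) where
  open CommutativeRing R
  open IntegerCoefficients R

  ∏ : ∀ {p} {P : Set p} → (P → Carrier) → List P → Carrier
  ∏ f [] = 1#
  ∏ f (x ∷ xs) = f x * ∏ f xs

  ∏-cong : ∀ {p} {P : Set p} {f g : P → Carrier} {xs} →
           All (λ x → f x ≈ g x) xs → ∏ f xs ≈ ∏ g xs
  ∏-cong [] = refl
  ∏-cong (e ∷ es) = *-cong e (∏-cong es)

  ∏-* : ∀ {p} {P : Set p} (f g : P → Carrier) xs → ∏ (λ x → f x * g x) xs ≈ ∏ f xs * ∏ g xs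
  ∏-* f g [] = sym (*-identityˡ 1#)
  ∏-* f g (x ∷ xs) = trans (*-congˡ (∏-* f g xs))
    (solve 4 (λ a b c d → (a :* b) :* (c :* d) := (a :* c) :* (b :* d)) refl (f x) (g x) (∏ f xs) (∏ g xs))

-- Res as Φ = Σ_a Φ(a) ∏_{b ≠ a} w(a,b) for a list of distinct points, the
-- sum of residues of a product of kernels with simple poles at the points.
module Residues {c ℓ p} (R : CommutativeRing c ℓ) (P : Set p)
                (w : P → P → CommutativeRing.Carrier R) where
  open CommutativeRing R
  open IntegerCoefficients R
  open Products R

  Res : List P → (P → Carrier) → Carrier
  Res [] Φ = 0#
  Res (a ∷ as) Φ = Φ a * ∏ (w a) as + Res as (λ b → Φ b * w b a)

  Res-cong : ∀ {as Φ Ψ} → All (λ a → Φ a ≈ Ψ a) as → Res as Φ ≈ Res as Ψ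
  Res-cong [] = refl
  Res-cong (e ∷ es) = +-cong (*-congʳ e) (Res-cong (All.map *-congʳ es))

  Res-ext : ∀ as {Φ Ψ} → (∀ a → Φ a ≈ Ψ a) → Res as Φ ≈ Res as Ψ
  Res-ext as e = Res-cong (All.universal e as)

  Res-+ : ∀ as Φ Ψ → Res as (λ a → Φ a + Ψ a) ≈ Res as Φ + Res as Ψ
  Res-+ [] Φ Ψ = sym (+-identityˡ 0#)
  Res-+ (a ∷ as) Φ Ψ = trans
    (+-congˡ (trans (Res-ext as (λ b → distribʳ (w b a) (Φ b) (Ψ b))) (Res-+ as _ _)))
    (solve 5 (λ f g x r s → (f :+ g) :* x :+ (r :+ s) := (f :* x :+ r) :+ (g :* x :+ s))
      refl (Φ a) (Ψ a) (∏ (w a) as) (Res as (λ b → Φ b * w b a)) (Res as (λ b → Ψ b * w b a)))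

  Res-* : ∀ as k Φ → Res as (λ a → k * Φ a) ≈ k * Res as Φ
  Res-* [] k Φ = sym (zeroʳ k)
  Res-* (a ∷ as) k Φ = trans
    (+-congˡ (trans (Res-ext as (λ b → *-assoc k (Φ b) (w b a))) (Res-* as k _)))
    (solve 4 (λ k f x r → (k :* f) :* x :+ k :* r := k :* (f :* x :+ r))
      refl k (Φ a) (∏ (w a) as) (Res as (λ b → Φ b * w b a)))

-- For cotangent-like kernels a product of n kernels expands into partial
-- fractions with constant term C n and residue sum S n.
module PartialFractions {c ℓ p} (R : CommutativeRing c ℓ) (P : Set p)
                        (w : P → P → CommutativeRing.Carrier R)
                        (z : CommutativeRing.Carrier R)
                        (_#_ : P → P → Set) where
  open CommutativeRing R
  open IntegerCoefficients R
  open Products R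
  open Residues R P w

  -- The kernel √z coth tends to ±√z at the two ends of a period strip, so a product of n kernels
  -- tends to (±√z)^n. `C n` is half the sum of these two limits, `S n` half their difference
  -- divided by √z.
  C S : ℕ → Carrier
  C zero = 1#
  C (suc n) = z * S n
  S zero = 0#
  S (suc n) = C n

  module _ (w-anti : ∀ {a b} → a # b → w b a ≈ - w a b)
           (w-mul : ∀ {x a b} → x # a → x # b → a # b →
                    w x a * w x b ≈ z + w a b * (w x a - w x b)) where

    -- The addition law splits each product `w x a * w x b` into a pole at `a`, a pole at `b` and
    -- the constant `z`. The constants add up to `z` times the residue sum of the tail; the
    -- coefficients of the pole at `a` assemble to the expansion of the tail at `a`.
    expand : ∀ {x} as → AllPairs _#_ as → All (x #_) as →
             ∏ (w x) as ≈ C (length as) + Res as (w x)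
    -- The residue at the new point `a` is the tail product at `a`. Its own expansion contains the
    -- terms `w a b`, which by antisymmetry cancel the change of the other residues; only the
    -- constant term survives.
    residue-sum : ∀ as → AllPairs _#_ as → Res as (λ _ → 1#) ≈ S (length as)

    expand [] _ _ = sym (+-identityʳ 1#)
    expand {x} (a ∷ as) (a# ∷ as#) (x#a ∷ x#) = begin
      w x a * ∏ (w x) as
        ≈⟨ *-congˡ (expand as as# x#) ⟩
      w x a * (C n + Res as (w x))
        ≈⟨ trans (distribˡ _ _ _) (+-congˡ (sym (Res-* as _ _))) ⟩
      w x a * C n + Res as (λ b → w x a * w x b)
        ≈⟨ +-congˡ (Res-cong (All.zipWith product (x# , a#))) ⟩
      w x a * C n + Res as (λ b → (z * 1# + w x a * w a b) + w x b * w b a)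
        ≈⟨ +-congˡ (trans (Res-+ as _ _) (+-congʳ (trans (Res-+ as _ _) (+-cong (Res-* as _ _) (Res-* as _ _))))) ⟩
      w x a * C n + ((z * Res as (λ _ → 1#) + w x a * Res as (w a)) + Res as (λ b → w x b * w b a))
        ≈⟨ solve 6 (λ u c z s r q → u :* c :+ ((z :* s :+ u :* r) :+ q) := z :* s :+ (u :* (c :+ r) :+ q))
             refl (w x a) (C n) z (Res as (λ _ → 1#)) (Res as (w a)) (Res as (λ b → w x b * w b a)) ⟩
      z * Res as (λ _ → 1#) + (w x a * (C n + Res as (w a)) + Res as (λ b → w x b * w b a))
        ≈⟨ +-cong (*-congˡ (residue-sum as as#)) (+-congʳ (*-congˡ (sym (expand as as# a#)))) ⟩
      z * S n + (w x a * ∏ (w a) as + Res as (λ b → w x b * w b a)) ∎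
      where
      open import Relation.Binary.Reasoning.Setoid setoid
      n = length as
      product : ∀ {b} → x # b × a # b → w x a * w x b ≈ (z * 1# + w x a * w a b) + w x b * w b a
      product {b} (x#b , a#b) = begin
        w x a * w x b                                ≈⟨ w-mul x#a x#b a#b ⟩
        z + w a b * (w x a - w x b)                  ≈⟨ solve 4 (λ z u v t → z :+ t :* (u :- v) := (z :* :1 :+ u :* t) :+ v :* (:- t))
                                                          refl z (w x a) (w x b) (w a b) ⟩
        (z * 1# + w x a * w a b) + w x b * (- w a b) ≈⟨ +-congˡ (*-congˡ (sym (w-anti a#b))) ⟩
        (z * 1# + w x a * w a b) + w x b * w b a     ∎

    residue-sum [] _ = refl
    residue-sum (a ∷ as) (a# ∷ as#) = begin
      1# * ∏ (w a) as + Res as (λ b → 1# * w b a)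
        ≈⟨ +-cong (trans (*-identityˡ _) (expand as as# a#)) (Res-cong (All.map anti a#)) ⟩
      (C n + Res as (w a)) + Res as (λ b → - 1# * w a b)
        ≈⟨ +-congˡ (Res-* as _ _) ⟩
      (C n + Res as (w a)) + - 1# * Res as (w a)
        ≈⟨ solve 2 (λ c r → (c :+ r) :+ (:- :1) :* r := c) refl (C n) (Res as (w a)) ⟩
      C n ∎
      where
      open import Relation.Binary.Reasoning.Setoid setoid
      n = length as
      anti : ∀ {b} → a # b → 1# * w b a ≈ - 1# * w a b
      anti {b} a#b = trans (*-congˡ (w-anti a#b))
        (solve 1 (λ u → :1 :* (:- u) := (:- :1) :* u) refl (w a b))

-- The degenerate (rational) kernel u(a,b) = 1/(a-b).
module RationalKernel {c ℓ p} (R : CommutativeRing c ℓ) (P : Set p)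
                      (u : P → P → CommutativeRing.Carrier R)
                      (pos : P → CommutativeRing.Carrier R)
                      (_#_ : P → P → Set) where
  open CommutativeRing R
  open IntegerCoefficients R
  open Products R

  -- This is (a - b - 1)/(a - b), the factor by which the difference to `b` changes when `a` is
  -- lowered by one.
  v : P → P → Carrier
  v a b = 1# - u a b

  open Residues R P v

  module _ (u-anti : ∀ {a b} → a # b → u b a ≈ - u a b)
           (u-mul : ∀ {x a b} → x # a → x # b → a # b →
                    u x a * u x b ≈ u a b * (u x a - u x b))
           (u-pos : ∀ {a b} → a # b → u a b * (pos a - pos b) ≈ 1#) where
    open import Relation.Binary.Reasoning.Setoid setoid

    -- Partial fractions of ∏ (1 - 1/(x - a)) in x: the value at infinity is 1, and the residue at
    -- `a` is minus the product over the other points.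
    expand : ∀ {x} as → AllPairs _#_ as → All (x #_) as →
             ∏ (v x) as + Res as (u x) ≈ 1#
    expand [] _ _ = +-identityʳ 1#
    expand {x} (a ∷ as) (a# ∷ as#) (x#a ∷ x#) = begin
      v x a * ∏ (v x) as + (u x a * ∏ (v a) as + Res as (λ b → u x b * v b a))
        ≈⟨ +-congˡ (+-congˡ (Res-cong (All.zipWith product (x# , a#)))) ⟩
      v x a * ∏ (v x) as + (u x a * ∏ (v a) as + Res as (λ b → v x a * u x b + u x a * u a b))
        ≈⟨ +-congˡ (+-congˡ (trans (Res-+ as _ _) (+-cong (Res-* as _ _) (Res-* as _ _)))) ⟩
      v x a * ∏ (v x) as + (u x a * ∏ (v a) as + (v x a * Res as (u x) + u x a * Res as (u a)))
        ≈⟨ solve 6 (λ s t p q r k → s :* p :+ (t :* q :+ (s :* r :+ t :* k)) := s :* (p :+ r) :+ t :* (q :+ k))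
             refl (v x a) (u x a) (∏ (v x) as) (∏ (v a) as) (Res as (u x)) (Res as (u a)) ⟩
      v x a * (∏ (v x) as + Res as (u x)) + u x a * (∏ (v a) as + Res as (u a))
        -- The induction hypothesis is used at `x` and at `a`; its weights `v x a` and `u x a` add
        -- up to 1.
        ≈⟨ +-cong (*-congˡ (expand as as# x#)) (*-congˡ (expand as as# a#)) ⟩
      v x a * 1# + u x a * 1#
        ≈⟨ solve 1 (λ u → (:1 :- u) :* :1 :+ u :* :1 := :1) refl (u x a) ⟩
      1# ∎
      where
      product : ∀ {b} → x # b × a # b → u x b * v b a ≈ v x a * u x b + u x a * u a b
      product {b} (x#b , a#b) = begin
        u x b * (1# - u b a)           ≈⟨ *-congˡ (+-congˡ (-‿cong (u-anti a#b))) ⟩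
        u x b * (1# - - u a b)         ≈⟨ solve 3 (λ p q r → q :* (:1 :- (:- r)) := (q :- r :* (p :- q)) :+ p :* r)
                                            refl (u x a) (u x b) (u a b) ⟩
        (u x b - u a b * (u x a - u x b)) + u x a * u a b ≈⟨ +-congʳ (+-congˡ (-‿cong (sym (u-mul x#a x#b a#b)))) ⟩
        (u x b - u x a * u x b) + u x a * u a b ≈⟨ +-congʳ (solve 2 (λ p q → q :- p :* q := (:1 :- p) :* q) refl (u x a) (u x b)) ⟩
        v x a * u x b + u x a * u a b  ∎

    -- Because `v b a` is `1 + u a b`, the new point leaves the old residue sum intact up to poles
    -- at `a`, and `expand` completes these to 1. Iterated, the residues count the points.
    Res-1-∷ : ∀ a as → AllPairs _#_ (a ∷ as) → Res (a ∷ as) (λ _ → 1#) ≈ 1# + Res as (λ _ → 1#)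
    Res-1-∷ a as (a# ∷ as#) = begin
      1# * ∏ (v a) as + Res as (λ b → 1# * v b a)
        ≈⟨ +-congˡ (Res-cong (All.map split a#)) ⟩
      1# * ∏ (v a) as + Res as (λ b → 1# + u a b)
        ≈⟨ +-congˡ (Res-+ as _ _) ⟩
      1# * ∏ (v a) as + (Res as (λ _ → 1#) + Res as (u a))
        ≈⟨ solve 3 (λ p n r → :1 :* p :+ (n :+ r) := (p :+ r) :+ n) refl _ _ _ ⟩
      (∏ (v a) as + Res as (u a)) + Res as (λ _ → 1#)
        ≈⟨ +-congʳ (expand as as# a#) ⟩
      1# + Res as (λ _ → 1#) ∎
      where
      split : ∀ {b} → a # b → 1# * v b a ≈ 1# + u a b
      split {b} a#b = trans (*-congˡ (+-congˡ (-‿cong (u-anti a#b))))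
        (solve 1 (λ r → :1 :* (:1 :- (:- r)) := :1 :+ r) refl (u a b))

    -- Iterated with `Res-1-∷`, the residues weighted by position give the sum of the positions
    -- minus n(n-1)/2, which for first-column hook lengths is the size of the partition.
    Res-pos-∷ : ∀ a as → AllPairs _#_ (a ∷ as) →
                Res (a ∷ as) pos + Res as (λ _ → 1#) ≈ pos a + Res as pos
    Res-pos-∷ a as (a# ∷ as#) = begin
      (pos a * ∏ (v a) as + Res as (λ b → pos b * v b a)) + Res as (λ _ → 1#)
        ≈⟨ solve 3 (λ p q r → (p :+ q) :+ r := p :+ (q :+ r)) refl _ _ _ ⟩
      pos a * ∏ (v a) as + (Res as (λ b → pos b * v b a) + Res as (λ _ → 1#))
        ≈⟨ +-congˡ (Res-+ as _ _) ⟨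
      pos a * ∏ (v a) as + Res as (λ b → pos b * v b a + 1#)
        ≈⟨ +-congˡ (Res-cong (All.map split a#)) ⟩
      pos a * ∏ (v a) as + Res as (λ b → pos a * u a b + pos b)
        ≈⟨ +-congˡ (trans (Res-+ as _ _) (+-congʳ (Res-* as _ _))) ⟩
      pos a * ∏ (v a) as + (pos a * Res as (u a) + Res as pos)
        ≈⟨ solve 4 (λ p x y r → p :* x :+ (p :* y :+ r) := p :* (x :+ y) :+ r) refl _ _ _ _ ⟩
      pos a * (∏ (v a) as + Res as (u a)) + Res as pos
        ≈⟨ +-congʳ (trans (*-congˡ (expand as as# a#)) (*-identityʳ _)) ⟩
      pos a + Res as pos ∎
      where
      split : ∀ {b} → a # b → pos b * v b a + 1# ≈ pos a * u a b + pos b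
      split {b} a#b = begin
        pos b * (1# - u b a) + 1#
          ≈⟨ +-cong (*-congˡ (+-congˡ (-‿cong (u-anti a#b)))) (sym (u-pos a#b)) ⟩
        pos b * (1# - - u a b) + u a b * (pos a - pos b)
          ≈⟨ solve 3 (λ p q r → q :* (:1 :- (:- r)) :+ r :* (p :- q) := p :* r :+ q) refl (pos a) (pos b) (u a b) ⟩
        pos a * u a b + pos b ∎

-- Vandermonde-like products under a change of one entry.

module Bumps {c ℓ} (R : CommutativeRing c ℓ) where
  open CommutativeRing R

  -- Every entry is changed in turn, with no test for admissibility: the functions it is applied to
  -- vanish at the inadmissible results.
  bump : (ℕ → ℕ) → (List ℕ → Carrier) → List ℕ → Carrier
  bump f g [] = 0#
  bump f g (b ∷ bs) = g (f b ∷ bs) + bump f (g ∘ (b ∷_)) bs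

  bump-cong-length : ∀ f {g h} bs → (∀ cs → length cs ≡ length bs → g cs ≈ h cs) → bump f g bs ≈ bump f h bs
  bump-cong-length f [] e = refl
  bump-cong-length f (b ∷ bs) e = +-cong (e _ ≡.refl) (bump-cong-length f bs (λ cs eq → e (b ∷ cs) (≡.cong suc eq)))

  bump-cong : ∀ f {g h} bs → (∀ cs → g cs ≈ h cs) → bump f g bs ≈ bump f h bs
  bump-cong f bs e = bump-cong-length f bs (λ cs _ → e cs)

  bump-* : ∀ f k g bs → bump f (λ cs → k * g cs) bs ≈ k * bump f g bs
  bump-* f k g [] = sym (zeroʳ k)
  bump-* f k g (b ∷ bs) = trans (+-congˡ (bump-* f k _ bs)) (sym (distribˡ k _ _))

-- Two instances matter: `t n` = tanh (nθ)/√z with tanh θ = √z over power series, and its limit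
-- `t n` = n over ℚ. The passage from hooks to first-column hook lengths is made once for both.
-- Inverses are data because the ring has no division.
record Tangents {c ℓ} (R : CommutativeRing c ℓ) : Set (c ⊔ ℓ) where
  open CommutativeRing R
  field
    t w : ℕ → Carrier
    t-0 : t 0 ≈ 0#
    t-1 : t 1 ≈ 1#
    w*t : ∀ n → w (suc n) * t (suc n) ≈ 1#

module Vandermonde {c ℓ} {R : CommutativeRing c ℓ} (T : Tangents R) where
  open CommutativeRing R
  open Tangents T
  open IntegerCoefficients R
  open Products R
  open Bumps R
  open import Algebra.Properties.Group +-group using (⁻¹-involutive; ε⁻¹≈ε)
  open import Relation.Binary.Reasoning.Setoid setoid

  -- the odd extension of f, at a - b
  oddly : (ℕ → Carrier) → ℕ → ℕ → Carrier
  oddly f a zero = f a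
  oddly f zero (suc b) = - f (suc b)
  oddly f (suc a) (suc b) = oddly f a b

  τ W : ℕ → ℕ → Carrier
  τ = oddly t
  W = oddly w

  τ-anti : ∀ a b → τ b a ≈ - τ a b
  τ-anti zero zero = trans t-0 (sym (trans (-‿cong t-0) ε⁻¹≈ε))
  τ-anti zero (suc b) = sym (⁻¹-involutive _)
  τ-anti (suc a) zero = refl
  τ-anti (suc a) (suc b) = τ-anti a b

  τ-refl : ∀ a → τ a a ≈ 0#
  τ-refl zero = t-0
  τ-refl (suc a) = τ-refl a

  τ-suc : ∀ a → τ (suc a) a ≈ 1#
  τ-suc zero = t-1
  τ-suc (suc a) = τ-suc a

  W-anti : ∀ {a b} → a ≢ b → W b a ≈ - W a b
  W-anti {zero} {zero} a≢b = ⊥-elim (a≢b ≡.refl)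
  W-anti {zero} {suc b} a≢b = sym (⁻¹-involutive _)
  W-anti {suc a} {zero} a≢b = refl
  W-anti {suc a} {suc b} a≢b = W-anti (a≢b ∘ ≡.cong suc)

  W*τ : ∀ {a b} → a ≢ b → W a b * τ a b ≈ 1#
  W*τ {zero} {zero} a≢b = ⊥-elim (a≢b ≡.refl)
  W*τ {zero} {suc b} a≢b = trans (solve 2 (λ x y → (:- x) :* (:- y) := x :* y) refl _ _) (w*t b)
  W*τ {suc a} {zero} a≢b = w*t a
  W*τ {suc a} {suc b} a≢b = W*τ (a≢b ∘ ≡.cong suc)

  w-1 : w 1 ≈ 1#
  w-1 = trans (sym (*-identityʳ _)) (trans (*-congˡ (sym t-1)) (w*t 0))

  w! : ℕ → Carrier
  w! zero = 1#
  w! (suc n) = w (suc n) * w! n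

  -- Division by W(b_i - b_j) is written as multiplication by `τ`, so that the product makes sense,
  -- and is zero, when two entries coincide.
  V : List ℕ → Carrier
  V [] = 1#
  V (b ∷ bs) = w! b * ∏ (τ b) bs * V bs

  -- The ratio of `τ (f a) b` to `τ a b`.
  v : (ℕ → ℕ) → ℕ → ℕ → Carrier
  v f a b = W a b * τ (f a) b

  module Bump (f : ℕ → ℕ) (κ : ℕ → Carrier) where
    open Residues R ℕ (v f)

    ∏τ-bump : ∀ {b bs} → All (b ≢_) bs → ∏ (τ (f b)) bs ≈ ∏ (τ b) bs * ∏ (v f b) bs
    ∏τ-bump {b} {bs} b≢ = trans (∏-cong (All.map ratio b≢)) (∏-* (τ b) (v f b) bs)
      where
      ratio : ∀ {c} → b ≢ c → τ (f b) c ≈ τ b c * v f b c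
      ratio {c} b≢c = begin
        τ (f b) c                       ≈⟨ *-identityˡ _ ⟨
        1# * τ (f b) c                  ≈⟨ *-congʳ (W*τ b≢c) ⟨
        W b c * τ b c * τ (f b) c       ≈⟨ solve 3 (λ x y z → x :* y :* z := y :* (x :* z)) refl _ _ _ ⟩
        τ b c * (W b c * τ (f b) c)     ∎

    -- `τ` and `W` both change sign when their arguments are exchanged, so the ratio is the same
    -- whether the changed entry stands first or second in the pair.
    τ-bump : ∀ {b c} → b ≢ c → τ b (f c) ≈ τ b c * v f c b
    τ-bump {b} {c} b≢c = begin
      τ b (f c)                       ≈⟨ *-identityˡ _ ⟨
      1# * τ b (f c)                  ≈⟨ *-cong (sym (W*τ b≢c)) (τ-anti (f c) b) ⟩
      W b c * τ b c * - τ (f c) b     ≈⟨ solve 3 (λ x y z → x :* y :* (:- z) := y :* ((:- x) :* z)) refl _ _ _ ⟩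
      τ b c * (- W b c * τ (f c) b)   ≈⟨ *-congˡ (*-congʳ (W-anti b≢c)) ⟨
      τ b c * (W c b * τ (f c) b)     ∎

    -- The weight m accounts for the factors contributed by earlier entries.
    bump-∏*V : ∀ (m φ : ℕ → Carrier) bs → AllPairs _≢_ bs →
               All (λ b → w! (f b) ≈ w! b * κ b) bs → All (λ b → m (f b) ≈ m b * φ b) bs →
               bump f (λ cs → ∏ m cs * V cs) bs ≈ ∏ m bs * V bs * Res bs (λ b → φ b * κ b)
    bump-∏*V m φ [] _ _ _ = sym (zeroʳ _)
    bump-∏*V m φ (b ∷ bs) (b≢ ∷ bs≢) (κb ∷ κs) (φb ∷ φs) = begin
      m (f b) * ∏ m bs * (w! (f b) * ∏ (τ (f b)) bs * V bs) + bump f (λ cs → m b * ∏ m cs * (w! b * ∏ (τ b) cs * V cs)) bs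
        ≈⟨ +-cong (*-cong (*-congʳ φb) (*-congʳ (*-cong κb (∏τ-bump b≢)))) tail ⟩
      m b * φ b * ∏ m bs * (w! b * κ b * (∏ (τ b) bs * ∏ (v f b) bs) * V bs)
        + m b * w! b * (∏ m bs * ∏ (τ b) bs * V bs * Res bs (λ c → φ c * κ c * v f c b))
        ≈⟨ solve 9 (λ m φ M w k t v V r →
             m :* φ :* M :* (w :* k :* (t :* v) :* V) :+ m :* w :* (M :* t :* V :* r)
               := m :* M :* (w :* t :* V) :* (φ :* k :* v :+ r))
             refl (m b) (φ b) (∏ m bs) (w! b) (κ b) (∏ (τ b) bs) (∏ (v f b) bs) (V bs) _ ⟩
      m b * ∏ m bs * (w! b * ∏ (τ b) bs * V bs) * (φ b * κ b * ∏ (v f b) bs + Res bs (λ c → φ c * κ c * v f c b)) ∎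
      where
      tail : bump f (λ cs → m b * ∏ m cs * (w! b * ∏ (τ b) cs * V cs)) bs
           ≈ m b * w! b * (∏ m bs * ∏ (τ b) bs * V bs * Res bs (λ c → φ c * κ c * v f c b))
      tail = begin
        bump f (λ cs → m b * ∏ m cs * (w! b * ∏ (τ b) cs * V cs)) bs
          ≈⟨ bump-cong f bs (λ cs → trans
               (solve 5 (λ m M w t V → m :* M :* (w :* t :* V) := m :* w :* (M :* t :* V)) refl (m b) (∏ m cs) (w! b) (∏ (τ b) cs) (V cs))
               (*-congˡ (*-congʳ (sym (∏-* m (τ b) cs))))) ⟩
        bump f (λ cs → m b * w! b * (∏ (λ c → m c * τ b c) cs * V cs)) bs
          ≈⟨ bump-* f _ _ bs ⟩
        m b * w! b * bump f (λ cs → ∏ (λ c → m c * τ b c) cs * V cs) bs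
          ≈⟨ *-congˡ (bump-∏*V (λ c → m c * τ b c) (λ c → φ c * v f c b) bs bs≢ κs (All.zipWith weight (φs , b≢))) ⟩
        m b * w! b * (∏ (λ c → m c * τ b c) bs * V bs * Res bs (λ c → φ c * v f c b * κ c))
          ≈⟨ *-congˡ (*-cong (*-congʳ (∏-* m (τ b) bs)) (Res-ext bs (λ c → solve 3 (λ x y z → x :* y :* z := x :* z :* y) refl (φ c) (v f c b) (κ c)))) ⟩
        m b * w! b * (∏ m bs * ∏ (τ b) bs * V bs * Res bs (λ c → φ c * κ c * v f c b)) ∎
        where
        weight : ∀ {c} → m (f c) ≈ m c * φ c × b ≢ c → m (f c) * τ b (f c) ≈ m c * τ b c * (φ c * v f c b)
        weight {c} (e , b≢c) = trans (*-cong e (τ-bump b≢c))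
          (solve 4 (λ x y z t → x :* y :* (z :* t) := x :* z :* (y :* t)) refl (m c) (φ c) (τ b c) (v f c b))

    -- Changing `b` multiplies `V` by `κ b` and by one ratio `v f b c` for each other entry `c`,
    -- which is exactly the summand of a residue sum.
    bump-V : ∀ bs → AllPairs _≢_ bs → All (λ b → w! (f b) ≈ w! b * κ b) bs →
             bump f V bs ≈ V bs * Res bs κ
    bump-V bs bs≢ κs = begin
      bump f V bs                                         ≈⟨ bump-cong f bs (λ cs → sym (trans (*-congʳ (∏-1 cs)) (*-identityˡ _))) ⟩
      bump f (λ cs → ∏ (λ _ → 1#) cs * V cs) bs           ≈⟨ bump-∏*V (λ _ → 1#) (λ _ → 1#) bs bs≢ κs (All.universal (λ _ → sym (*-identityˡ 1#)) bs) ⟩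
      ∏ (λ _ → 1#) bs * V bs * Res bs (λ b → 1# * κ b)    ≈⟨ *-cong (trans (*-congʳ (∏-1 bs)) (*-identityˡ _)) (Res-ext bs (λ b → *-identityˡ _)) ⟩
      V bs * Res bs κ                                     ∎
      where
      ∏-1 : ∀ cs → ∏ (λ _ → 1#) cs ≈ 1#
      ∏-1 [] = refl
      ∏-1 (c ∷ cs) = trans (*-identityˡ _) (∏-1 cs)

  -- The effect on first-column hook lengths of appending a row of length `k`: all earlier ones grow
  -- by one.
  new : ℕ → List ℕ → List ℕ
  new k [] = k ∷ []
  new k (b ∷ bs) = suc b ∷ new k bs

  ∏τ-new : ∀ k b cs → ∏ (τ (suc b)) (new k cs) ≈ ∏ (τ b) cs * τ (suc b) k
  ∏τ-new k b [] = *-comm _ _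
  ∏τ-new k b (c ∷ cs) = trans (*-congˡ (∏τ-new k b cs)) (sym (*-assoc _ _ _))

  -- Each `w! b` gains the factor `w (suc b)`, and the raised entry differs from the new entry 1 by
  -- `b`. The product obtained is what the point at 0 contributes to the residue sum below.
  V-new : ∀ bs → V (new 1 bs) ≈ V bs * ∏ (λ b → w (suc b) * t b) bs
  V-new [] = trans (solve 1 (λ x → x :* :1 :* :1 :* :1 := x :* :1) refl (w 1))
    (*-congʳ w-1)
  V-new (b ∷ bs) = begin
    w (suc b) * w! b * ∏ (τ (suc b)) (new 1 bs) * V (new 1 bs)
      ≈⟨ *-cong (*-congˡ (∏τ-new 1 b bs)) (V-new bs) ⟩
    w (suc b) * w! b * (∏ (τ b) bs * t b) * (V bs * ∏ (λ b → w (suc b) * t b) bs)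
      ≈⟨ solve 6 (λ w W p t V q → w :* W :* (p :* t) :* (V :* q) := W :* p :* V :* (w :* t :* q)) refl _ _ _ _ _ _ ⟩
    w! b * ∏ (τ b) bs * V bs * (w (suc b) * t b * ∏ (λ b → w (suc b) * t b) bs) ∎

  -- An empty row costs nothing: the new factor `w (suc b)` is cancelled by `t (suc b)`, the pair
  -- with the new entry 0.
  V-shift : ∀ bs → V (new 0 bs) ≈ V bs
  V-shift [] = trans (*-identityʳ _) (*-identityʳ _)
  V-shift (b ∷ bs) = begin
    w (suc b) * w! b * ∏ (τ (suc b)) (new 0 bs) * V (new 0 bs)
      ≈⟨ *-cong (*-congˡ (∏τ-new 0 b bs)) (V-shift bs) ⟩
    w (suc b) * w! b * (∏ (τ b) bs * t (suc b)) * V bs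
      ≈⟨ solve 5 (λ w W p t V → w :* W :* (p :* t) :* V := w :* t :* (W :* p :* V)) refl _ _ _ _ _ ⟩
    w (suc b) * t (suc b) * (w! b * ∏ (τ b) bs * V bs)
      ≈⟨ trans (*-congʳ (w*t b)) (*-identityˡ _) ⟩
    w! b * ∏ (τ b) bs * V bs ∎

  w!-suc : ∀ b → w! (suc b) ≈ w! b * w (suc b)
  w!-suc b = *-comm _ _

  w!-pred : ∀ {b} → 0 < b → w! (pred b) ≈ w! b * t b
  w!-pred {suc b} _ = sym (trans (solve 3 (λ w x t → w :* x :* t := w :* t :* x) refl (w (suc b)) (w! b) (t (suc b)))
    (trans (*-congʳ (w*t b)) (*-identityˡ _)))

-- The addition theorem and the residue identity behind D G = z d G.

-- Non-zero-divisors take the place of units, since `z` has to be cancelled in a ring of power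
-- series.
Cancellable : ∀ {c ℓ} (R : CommutativeRing c ℓ) → CommutativeRing.Carrier R → Set (c ⊔ ℓ)
Cancellable R x = ∀ {y} → x * y ≈ 0# → y ≈ 0#
  where open CommutativeRing R

-- a n + √z b n = (1 + √z)^n, so that t n = tanh (n artanh √z) / √z.
record AdditionLaw {c ℓ} {R : CommutativeRing c ℓ} (T : Tangents R) : Set (c ⊔ ℓ) where
  open CommutativeRing R
  open Tangents T
  field
    z : Carrier
    a b : ℕ → Carrier
    a-0 : a 0 ≈ 1#
    b-0 : b 0 ≈ 0#
    a-suc : ∀ n → a (suc n) ≈ a n + z * b n
    b-suc : ∀ n → b (suc n) ≈ a n + b n
    t*a : ∀ n → t n * a n ≈ b n
    w*b : ∀ n → w (suc n) * b (suc n) ≈ a (suc n)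
    z-cancel : Cancellable R z
    1-z-cancel : Cancellable R (1# - z)
    a-cancel : ∀ n → Cancellable R (a n)
    b-cancel : ∀ n → Cancellable R (b (suc n))

module Growth {c ℓ} {R : CommutativeRing c ℓ} {T : Tangents R} (A : AdditionLaw T) where
  open CommutativeRing R
  open Tangents T
  open AdditionLaw A
  open IntegerCoefficients R
  open Products R
  open Bumps R
  open Vandermonde T
  open import Algebra.Properties.Group +-group using (x∙y⁻¹≈ε⇒x≈y)
  open import Relation.Binary.Reasoning.Setoid setoid

  cancel : ∀ {x y k} → Cancellable R k → x * k ≈ y * k → x ≈ y
  cancel {x} {y} {k} k-cancel e = x∙y⁻¹≈ε⇒x≈y x y (k-cancel (begin
    k * (x - y)     ≈⟨ solve 3 (λ k x y → k :* (x :- y) := x :* k :- y :* k) refl k x y ⟩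
    x * k - y * k   ≈⟨ +-congʳ e ⟩
    y * k - y * k   ≈⟨ -‿inverseʳ _ ⟩
    0#              ∎))

  *-cancellable : ∀ {x y} → Cancellable R x → Cancellable R y → Cancellable R (x * y)
  *-cancellable xc yc e = yc (xc (trans (sym (*-assoc _ _ _)) e))

  neg-cancellable : ∀ {x} → Cancellable R x → Cancellable R (- x)
  neg-cancellable {x} xc {y} e = xc (trans (solve 2 (λ x y → x :* y := :- ((:- x) :* y)) refl x y)
    (trans (-‿cong e) (solve 0 (:- :0 := :0) refl)))

  ≈-cancellable : ∀ {x y} → x ≈ y → Cancellable R x → Cancellable R y
  ≈-cancellable x≈y xc e = xc (trans (*-congʳ x≈y) e)

  -- (1 + √z)^m (1 - √z)^n = M m n + √z N m n
  N M : ℕ → ℕ → Carrier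
  N m n = b m * a n - a m * b n
  M m n = a m * a n - z * (b m * b n)

  -- Raising both exponents multiplies by (1 + √z)(1 - √z) = 1 - z. Hence the quotients of `N` and
  -- `M` depend on the difference of `m` and `n` alone, as `τ` and `W` do by definition.
  N-suc : ∀ m n → N (suc m) (suc n) ≈ (1# - z) * N m n
  N-suc m n = trans (+-cong (*-cong (b-suc m) (a-suc n)) (-‿cong (*-cong (a-suc m) (b-suc n))))
    (solve 5 (λ z a b α β → (a :+ b) :* (α :+ z :* β) :- (a :+ z :* b) :* (α :+ β) := (:1 :- z) :* (b :* α :- a :* β))
      refl z (a m) (b m) (a n) (b n))

  M-suc : ∀ m n → M (suc m) (suc n) ≈ (1# - z) * M m n
  M-suc m n = trans (+-cong (*-cong (a-suc m) (a-suc n)) (-‿cong (*-congˡ (*-cong (b-suc m) (b-suc n)))))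
    (solve 5 (λ z a b α β → (a :+ z :* b) :* (α :+ z :* β) :- z :* ((a :+ b) :* (α :+ β)) := (:1 :- z) :* (a :* α :- z :* (b :* β)))
      refl z (a m) (b m) (a n) (b n))

  N-0ʳ : ∀ m → N m 0 ≈ b m
  N-0ʳ m = trans (+-cong (*-congˡ a-0) (-‿cong (*-congˡ b-0)))
    (solve 2 (λ a b → b :* :1 :- a :* :0 := b) refl (a m) (b m))

  N-0ˡ : ∀ n → N 0 n ≈ - b n
  N-0ˡ n = trans (+-cong (*-congʳ b-0) (-‿cong (*-congʳ a-0)))
    (solve 2 (λ a b → :0 :* a :- :1 :* b := :- b) refl (a n) (b n))

  M-0ʳ : ∀ m → M m 0 ≈ a m
  M-0ʳ m = trans (+-cong (*-congˡ a-0) (-‿cong (*-congˡ (*-congˡ b-0))))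
    (solve 3 (λ z a b → a :* :1 :- z :* (b :* :0) := a) refl z (a m) (b m))

  M-0ˡ : ∀ n → M 0 n ≈ a n
  M-0ˡ n = trans (+-cong (*-congʳ a-0) (-‿cong (*-congˡ (*-congʳ b-0))))
    (solve 3 (λ z a b → :1 :* a :- z :* (:0 :* b) := a) refl z (a n) (b n))

  N-cancel : ∀ {m n} → m ≢ n → Cancellable R (N m n)
  N-cancel {zero} {zero} m≢n = ⊥-elim (m≢n ≡.refl)
  N-cancel {suc m} {zero} m≢n = ≈-cancellable (sym (N-0ʳ (suc m))) (b-cancel m)
  N-cancel {zero} {suc n} m≢n = ≈-cancellable (sym (N-0ˡ (suc n))) (neg-cancellable (b-cancel n))
  N-cancel {suc m} {suc n} m≢n = ≈-cancellable (sym (N-suc m n)) (*-cancellable 1-z-cancel (N-cancel (m≢n ∘ ≡.cong suc)))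

  M-cancel : ∀ m n → Cancellable R (M m n)
  M-cancel m zero = ≈-cancellable (sym (M-0ʳ m)) (a-cancel m)
  M-cancel zero (suc n) = ≈-cancellable (sym (M-0ˡ (suc n))) (a-cancel (suc n))
  M-cancel (suc m) (suc n) = ≈-cancellable (sym (M-suc m n)) (*-cancellable 1-z-cancel (M-cancel m n))

  step : ∀ {x p q p′ q′} → p′ ≈ (1# - z) * p → q′ ≈ (1# - z) * q → x * p ≈ q → x * p′ ≈ q′
  step {x} {p} {q} ep eq e = trans (*-congˡ ep)
    (trans (solve 3 (λ x k p → x :* (k :* p) := k :* (x :* p)) refl x (1# - z) p) (trans (*-congˡ e) (sym eq)))

  -- The subtraction theorem of tanh with the denominator cleared. Descending in both indices only
  -- strips factors 1 - z, and at index 0 it is the defining relation of `t`.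
  τ*M : ∀ m n → τ m n * M m n ≈ N m n
  τ*M m zero = trans (*-congˡ (M-0ʳ m)) (trans (t*a m) (sym (N-0ʳ m)))
  τ*M zero (suc n) = trans (*-congˡ (M-0ˡ (suc n)))
    (trans (solve 2 (λ t a → (:- t) :* a := :- (t :* a)) refl _ _) (trans (-‿cong (t*a (suc n))) (sym (N-0ˡ (suc n)))))
  τ*M (suc m) (suc n) = step (M-suc m n) (N-suc m n) (τ*M m n)

  W*N : ∀ {m n} → m ≢ n → W m n * N m n ≈ M m n
  W*N {zero} {zero} m≢n = ⊥-elim (m≢n ≡.refl)
  W*N {suc m} {zero} m≢n = trans (*-congˡ (N-0ʳ (suc m))) (trans (w*b m) (sym (M-0ʳ (suc m))))
  W*N {zero} {suc n} m≢n = trans (*-congˡ (N-0ˡ (suc n)))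
    (trans (solve 2 (λ t a → (:- t) :* (:- a) := t :* a) refl _ _) (trans (w*b n) (sym (M-0ˡ (suc n)))))
  W*N {suc m} {suc n} m≢n = step (N-suc m n) (M-suc m n) (W*N (m≢n ∘ ≡.cong suc))

  -- The point (n , true) is n shifted by half the period of the tangent.
  Point : Set
  Point = ℕ × Bool

  _#_ : Point → Point → Set
  (m , false) # (n , false) = m ≢ n
  (m , true) # (n , true) = m ≢ n
  (m , false) # (n , true) = ⊤
  (m , true) # (n , false) = ⊤

  -- A shift by half a period turns √z coth into √z tanh, which is `z` times `τ`; shifting both
  -- points changes nothing. Mixed pairs never collide, so `_#_` asks nothing of them.
  κ : Point → Point → Carrier
  κ (m , false) (n , false) = W m n
  κ (m , true) (n , true) = W m n
  κ (m , false) (n , true) = z * τ m n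
  κ (m , true) (n , false) = z * τ m n

  -- `α + √z β` is (1 + √z)^n at an unshifted point and √z (1 + √z)^n at a shifted one:
  -- multiplication by √z exchanges the roles of tanh and coth.
  α β : Point → Carrier
  α (n , false) = a n
  α (n , true) = b n * z
  β (n , false) = b n
  β (n , true) = a n

  N′ M′ : Point → Point → Carrier
  N′ p q = β p * α q - α p * β q
  M′ p q = α p * α q - z * (β p * β q)

  -- In these coordinates the kernel is the quotient of `M′` by `N′` for all four kinds of pairs, so
  -- its addition law needs no case distinction.
  κ*N′ : ∀ p q → p # q → κ p q * N′ p q ≈ M′ p q
  κ*N′ (m , false) (n , false) p#q = W*N p#q
  κ*N′ (m , true) (n , true) p#q = begin
    W m n * (a m * (b n * z) - b m * z * a n)
      ≈⟨ solve 6 (λ w z a b α β → w :* (a :* (β :* z) :- b :* z :* α) := :- (z :* (w :* (b :* α :- a :* β)))) refl _ z (a m) (b m) (a n) (b n) ⟩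
    - (z * (W m n * N m n))
      ≈⟨ -‿cong (*-congˡ (W*N p#q)) ⟩
    - (z * M m n)
      ≈⟨ solve 5 (λ z a b α β → :- (z :* (a :* α :- z :* (b :* β))) := b :* z :* (β :* z) :- z :* (a :* α)) refl z (a m) (b m) (a n) (b n) ⟩
    b m * z * (b n * z) - z * (a m * a n) ∎
  κ*N′ (m , false) (n , true) _ = begin
    z * τ m n * (b m * (b n * z) - a m * a n)
      ≈⟨ solve 6 (λ z t a b α β → z :* t :* (b :* (β :* z) :- a :* α) := :- (z :* (t :* (a :* α :- z :* (b :* β))))) refl z _ (a m) (b m) (a n) (b n) ⟩
    - (z * (τ m n * M m n))
      ≈⟨ -‿cong (*-congˡ (τ*M m n)) ⟩
    - (z * N m n)
      ≈⟨ solve 5 (λ z a b α β → :- (z :* (b :* α :- a :* β)) := a :* (β :* z) :- z :* (b :* α)) refl z (a m) (b m) (a n) (b n) ⟩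
    a m * (b n * z) - z * (b m * a n) ∎
  κ*N′ (m , true) (n , false) _ = begin
    z * τ m n * (a m * a n - b m * z * b n)
      ≈⟨ solve 6 (λ z t a b α β → z :* t :* (a :* α :- b :* z :* β) := z :* (t :* (a :* α :- z :* (b :* β)))) refl z _ (a m) (b m) (a n) (b n) ⟩
    z * (τ m n * M m n)
      ≈⟨ *-congˡ (τ*M m n) ⟩
    z * N m n
      ≈⟨ solve 5 (λ z a b α β → z :* (b :* α :- a :* β) := b :* z :* α :- z :* (a :* β)) refl z (a m) (b m) (a n) (b n) ⟩
    b m * z * a n - z * (a m * b n) ∎

  N′-cancel : ∀ p q → p # q → Cancellable R (N′ p q)
  N′-cancel (m , false) (n , false) p#q = N-cancel p#q
  N′-cancel (m , true) (n , true) p#q = ≈-cancellable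
    (solve 5 (λ z a b α β → :- (z :* (b :* α :- a :* β)) := a :* (β :* z) :- b :* z :* α) refl z (a m) (b m) (a n) (b n))
    (neg-cancellable (*-cancellable z-cancel (N-cancel p#q)))
  N′-cancel (m , false) (n , true) _ = ≈-cancellable
    (solve 5 (λ z a b α β → :- (a :* α :- z :* (b :* β)) := b :* (β :* z) :- a :* α) refl z (a m) (b m) (a n) (b n))
    (neg-cancellable (M-cancel m n))
  N′-cancel (m , true) (n , false) _ = ≈-cancellable
    (solve 5 (λ z a b α β → a :* α :- z :* (b :* β) := a :* α :- b :* z :* β) refl z (a m) (b m) (a n) (b n))
    (M-cancel m n)

  κ-anti : ∀ {p q} → p # q → κ q p ≈ - κ p q
  κ-anti {m , false} {n , false} p#q = W-anti p#q
  κ-anti {m , true} {n , true} p#q = W-anti p#q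
  κ-anti {m , false} {n , true} _ = trans (*-congˡ (τ-anti m n)) (solve 2 (λ z t → z :* (:- t) := :- (z :* t)) refl z _)
  κ-anti {m , true} {n , false} _ = trans (*-congˡ (τ-anti m n)) (solve 2 (λ z t → z :* (:- t) := :- (z :* t)) refl z _)

  -- Once the three denominators `N′` are cleared, this is a polynomial identity in `z` and the six
  -- coordinates, valid for arbitrary values.
  κ-mul : ∀ {x p q} → x # p → x # q → p # q → κ x p * κ x q ≈ z + κ p q * (κ x p - κ x q)
  κ-mul {x} {p} {q} x#p x#q p#q =
    cancel (*-cancellable (N′-cancel x p x#p) (*-cancellable (N′-cancel x q x#q) (N′-cancel p q p#q))) (begin
      κ x p * κ x q * (N′ x p * (N′ x q * N′ p q))
        ≈⟨ solve 5 (λ k l f g h → k :* l :* (f :* (g :* h)) := (k :* f) :* (l :* g) :* h) refl _ _ _ _ _ ⟩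
      κ x p * N′ x p * (κ x q * N′ x q) * N′ p q
        ≈⟨ *-congʳ (*-cong (κ*N′ x p x#p) (κ*N′ x q x#q)) ⟩
      M′ x p * M′ x q * N′ p q
        ≈⟨ solve 7 (λ z α₁ β₁ α₂ β₂ α₃ β₃ →
             let N = λ α β α′ β′ → β :* α′ :- α :* β′
                 M = λ α β α′ β′ → α :* α′ :- z :* (β :* β′)
             in M α₁ β₁ α₂ β₂ :* M α₁ β₁ α₃ β₃ :* N α₂ β₂ α₃ β₃
                := z :* (N α₁ β₁ α₂ β₂ :* (N α₁ β₁ α₃ β₃ :* N α₂ β₂ α₃ β₃))
                   :+ M α₂ β₂ α₃ β₃ :* (M α₁ β₁ α₂ β₂ :* N α₁ β₁ α₃ β₃ :- M α₁ β₁ α₃ β₃ :* N α₁ β₁ α₂ β₂))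
             refl z (α x) (β x) (α p) (β p) (α q) (β q) ⟩
      z * (N′ x p * (N′ x q * N′ p q)) + M′ p q * (M′ x p * N′ x q - M′ x q * N′ x p)
        ≈⟨ +-congˡ (*-cong (κ*N′ p q p#q) (+-cong (*-congʳ (κ*N′ x p x#p)) (-‿cong (*-congʳ (κ*N′ x q x#q))))) ⟨
      z * (N′ x p * (N′ x q * N′ p q)) + κ p q * N′ p q * (κ x p * N′ x p * N′ x q - κ x q * N′ x q * N′ x p)
        ≈⟨ solve 7 (λ z k l m f g h → z :* (f :* (g :* h)) :+ m :* h :* (k :* f :* g :- l :* g :* f)
             := (z :+ m :* (k :- l)) :* (f :* (g :* h))) refl z (κ x p) (κ x q) (κ p q) (N′ x p) (N′ x q) (N′ p q) ⟩
      (z + κ p q * (κ x p - κ x q)) * (N′ x p * (N′ x q * N′ p q)) ∎)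

  -- The poles of coth x ∏ coth (x - n - 1) tanh (x - n). Up to powers of `z` and sign, the residue
  -- at `(suc n , false)` is the ratio of `V` for raising `n`, that at `(n , true)` the ratio for
  -- lowering `n`, and that at `(0 , false)` the ratio for a new row.
  points : List ℕ → List Point
  points [] = (0 , false) ∷ []
  points (n ∷ ns) = (suc n , false) ∷ (n , true) ∷ points ns

  open Residues R Point κ using () renaming (Res to Resκ)
  open Residues R ℕ (v suc) using () renaming (Res to Res⁺; Res-cong to Res⁺-cong; Res-* to Res⁺-*)
  open Residues R ℕ (v pred) using () renaming (Res to Res⁻; Res-cong to Res⁻-cong; Res-* to Res⁻-*)

  z^ : List ℕ → Carrier
  z^ = ∏ (λ _ → z)

  ∏κ-false : ∀ m ns → ∏ (κ (suc m , false)) (points ns) ≈ z^ ns * (w (suc m) * ∏ (v suc m) ns)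
  ∏κ-false m [] = solve 1 (λ w → w :* :1 := :1 :* (w :* :1)) refl (w (suc m))
  ∏κ-false m (n ∷ ns) = trans (*-congˡ (*-congˡ (∏κ-false m ns)))
    (solve 6 (λ W z t Z w p → W :* (z :* t :* (Z :* (w :* p))) := z :* Z :* (w :* (W :* t :* p))) refl (W m n) z (τ (suc m) n) (z^ ns) (w (suc m)) _)

  ∏κ-true : ∀ {m} → 0 < m → ∀ ns → ∏ (κ (m , true)) (points ns) ≈ z^ ns * (z * t m * ∏ (v pred m) ns)
  ∏κ-true {m} _ [] = solve 2 (λ z t → z :* t :* :1 := :1 :* (z :* t :* :1)) refl z (t m)
  ∏κ-true {suc m} 0<m (n ∷ ns) = trans (*-congˡ (*-congˡ (∏κ-true 0<m ns)))
    (solve 6 (λ W z t Z w p → z :* t :* (W :* (Z :* (z :* w :* p))) := z :* Z :* (z :* w :* (W :* t :* p))) refl (W (suc m) n) z (τ m n) (z^ ns) (t (suc m)) _)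

  -- Every pair of points of different kinds contributes a spare factor z.
  Res-points : ∀ ns Φ → AllPairs _≢_ ns → All (0 <_) ns →
    Resκ (points ns) Φ ≈ z^ ns * (Res⁺ ns (λ n → Φ (suc n , false) * w (suc n)) - z * Res⁻ ns (λ n → Φ (n , true) * t n)
                                  + Φ (0 , false) * ∏ (λ n → w (suc n) * t n) ns)
  Res-points [] Φ _ _ = solve 2 (λ z φ → φ :* :1 :+ :0 := :1 :* (:0 :- z :* :0 :+ φ :* :1)) refl z (Φ (0 , false))
  Res-points (suc m ∷ ns) Φ (m≢ ∷ ns≢) (0<m ∷ 0<ns) = begin
    Φ f * (z * τ (suc m) m * ∏ (κ f) (points ns)) + (Φ t′ * (z * τ m (suc m)) * ∏ (κ t′) (points ns) + Resκ (points ns) (λ x → Φ x * κ x f * κ x t′))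
      -- The two points made from the same entry have difference ±1, where `τ` is ±1. This yields
      -- the spare `z` of the entry and the minus sign of the lowering terms.
      ≈⟨ +-cong (*-congˡ (*-cong (trans (*-congˡ (τ-suc m)) (*-identityʳ z)) (∏κ-false (suc m) ns)))
           (+-cong (*-cong (*-congˡ (*-congˡ (trans (τ-anti (suc m) m) (-‿cong (τ-suc m))))) (∏κ-true 0<m ns)) (Res-points ns _ ns≢ 0<ns)) ⟩
    Φ f * (z * (Z * (w (suc (suc m)) * ∏ (v suc (suc m)) ns))) + (Φ t′ * (z * - 1#) * (Z * (z * t (suc m) * ∏ (v pred (suc m)) ns))
      + Z * (Res⁺ ns (λ n → Φ (suc n , false) * κ (suc n , false) f * κ (suc n , false) t′ * w (suc n))
             - z * Res⁻ ns (λ n → Φ (n , true) * κ (n , true) f * κ (n , true) t′ * t n)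
             + Φ (0 , false) * (- w (suc (suc m))) * (z * - t (suc m)) * ∏ (λ n → w (suc n) * t n) ns))
      ≈⟨ +-congˡ (+-congˡ (*-congˡ (+-congʳ (+-cong (trans (Res⁺-cong (All.universal false-step ns)) (Res⁺-* ns z _))
           (-‿cong (*-congˡ (trans (Res⁻-cong (All.map true-step 0<ns)) (Res⁻-* ns z _)))))))) ⟩
    Φ f * (z * (Z * (w (suc (suc m)) * ∏ (v suc (suc m)) ns))) + (Φ t′ * (z * - 1#) * (Z * (z * t (suc m) * ∏ (v pred (suc m)) ns))
      + Z * (z * Res⁺ ns (λ n → Φ (suc n , false) * w (suc n) * v suc n (suc m))
             - z * (z * Res⁻ ns (λ n → Φ (n , true) * t n * v pred n (suc m)))
             + Φ (0 , false) * (- w (suc (suc m))) * (z * - t (suc m)) * ∏ (λ n → w (suc n) * t n) ns))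
      ≈⟨ solve 12 (λ z Z φ ψ χ w t p q r s u →
           φ :* (z :* (Z :* (w :* p))) :+ (ψ :* (z :* (:- :1)) :* (Z :* (z :* t :* q))
             :+ Z :* (z :* r :- z :* (z :* s) :+ χ :* (:- w) :* (z :* (:- t)) :* u))
           := z :* Z :* (φ :* w :* p :+ r :- z :* (ψ :* t :* q :+ s) :+ χ :* (w :* t :* u)))
           refl z Z (Φ f) (Φ t′) (Φ (0 , false)) (w (suc (suc m))) (t (suc m)) (∏ (v suc (suc m)) ns) (∏ (v pred (suc m)) ns)
             (Res⁺ ns (λ n → Φ (suc n , false) * w (suc n) * v suc n (suc m))) (Res⁻ ns (λ n → Φ (n , true) * t n * v pred n (suc m)))
             (∏ (λ n → w (suc n) * t n) ns) ⟩
    z * Z * (Φ f * w (suc (suc m)) * ∏ (v suc (suc m)) ns + Res⁺ ns (λ n → Φ (suc n , false) * w (suc n) * v suc n (suc m))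
             - z * (Φ t′ * t (suc m) * ∏ (v pred (suc m)) ns + Res⁻ ns (λ n → Φ (n , true) * t n * v pred n (suc m)))
             + Φ (0 , false) * (w (suc (suc m)) * t (suc m) * ∏ (λ n → w (suc n) * t n) ns)) ∎
    where
    Z = z^ ns
    f t′ : Point
    f = suc (suc m) , false
    t′ = suc m , true
    false-step : ∀ n → Φ (suc n , false) * W n (suc m) * (z * τ (suc n) (suc m)) * w (suc n)
                       ≈ z * (Φ (suc n , false) * w (suc n) * (W n (suc m) * τ (suc n) (suc m)))
    false-step n = solve 5 (λ φ W z t w → φ :* W :* (z :* t) :* w := z :* (φ :* w :* (W :* t))) refl _ _ _ _ _
    true-step : ∀ {n} → 0 < n → Φ (n , true) * (z * τ n (suc (suc m))) * W n (suc m) * t n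
                       ≈ z * (Φ (n , true) * t n * (W n (suc m) * τ (pred n) (suc m)))
    true-step {suc n} _ = solve 5 (λ φ W z t w → φ :* (z :* t) :* W :* w := z :* (φ :* w :* (W :* t))) refl _ _ _ _ _

  points-# : ∀ ns → AllPairs _≢_ ns → AllPairs _#_ (points ns)
  points-# [] _ = [] ∷ []
  points-# (n ∷ ns) (n≢ ∷ ns≢) = (tt ∷ false-# ns n≢) ∷ true-# ns n≢ ∷ points-# ns ns≢
    where
    false-# : ∀ ms → All (n ≢_) ms → All ((suc n , false) #_) (points ms)
    false-# [] [] = (λ ()) ∷ []
    false-# (m ∷ ms) (n≢m ∷ n≢) = (n≢m ∘ ≡.cong pred) ∷ tt ∷ false-# ms n≢
    true-# : ∀ ms → All (n ≢_) ms → All ((n , true) #_) (points ms)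
    true-# [] [] = tt ∷ []
    true-# (m ∷ ms) (n≢m ∷ n≢) = tt ∷ n≢m ∷ true-# ms n≢

  open PartialFractions R Point κ z _#_ using (S; residue-sum)

  S-points : ∀ ns → S (length (points ns)) ≈ z^ ns
  S-points [] = refl
  S-points (n ∷ ns) = *-congˡ (S-points ns)

  z^-cancel : ∀ ns → Cancellable R (z^ ns)
  z^-cancel [] e = trans (sym (*-identityˡ _)) e
  z^-cancel (n ∷ ns) = *-cancellable z-cancel (z^-cancel ns)

  -- With weight 1 at 2n+1 points the total residue is `S` of 2n+1, that is z^n: the same power as
  -- the spare factors, which can therefore be cancelled.
  residues : ∀ ns → AllPairs _≢_ ns → All (0 <_) ns →
             Res⁺ ns (w ∘ suc) - z * Res⁻ ns t + ∏ (λ n → w (suc n) * t n) ns ≈ 1#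
  residues ns ns≢ 0<ns = cancel (z^-cancel ns) (begin
    (Res⁺ ns (w ∘ suc) - z * Res⁻ ns t + ∏ (λ n → w (suc n) * t n) ns) * z^ ns
      ≈⟨ *-comm _ _ ⟩
    z^ ns * (Res⁺ ns (w ∘ suc) - z * Res⁻ ns t + ∏ (λ n → w (suc n) * t n) ns)
      ≈⟨ *-congˡ (+-cong (+-cong (Res⁺-cong (All.universal (λ _ → *-identityˡ _) ns))
           (-‿cong (*-congˡ (Res⁻-cong (All.universal (λ _ → *-identityˡ _) ns))))) (*-identityˡ _)) ⟨
    z^ ns * (Res⁺ ns (λ n → 1# * w (suc n)) - z * Res⁻ ns (λ n → 1# * t n) + 1# * ∏ (λ n → w (suc n) * t n) ns)
      ≈⟨ Res-points ns (λ _ → 1#) ns≢ 0<ns ⟨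
    Resκ (points ns) (λ _ → 1#)
      ≈⟨ residue-sum κ-anti κ-mul (points ns) (points-# ns ns≢) ⟩
    S (length (points ns))
      ≈⟨ S-points ns ⟩
    z^ ns
      ≈⟨ *-identityˡ _ ⟨
    1# * z^ ns ∎)

  V-growth : ∀ ns → AllPairs _≢_ ns → All (0 <_) ns →
             bump suc V ns + V (new 1 ns) ≈ V ns + z * bump pred V ns
  V-growth ns ns≢ 0<ns = begin
    bump suc V ns + V (new 1 ns)
      ≈⟨ +-cong (Bump.bump-V suc (w ∘ suc) ns ns≢ (All.universal w!-suc ns)) (V-new ns) ⟩
    V ns * Res⁺ ns (w ∘ suc) + V ns * ∏ (λ n → w (suc n) * t n) ns
      ≈⟨ solve 5 (λ V p z q r → V :* p :+ V :* r := V :* (p :- z :* q :+ r) :+ z :* (V :* q)) refl (V ns) _ z (Res⁻ ns t) _ ⟩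
    V ns * (Res⁺ ns (w ∘ suc) - z * Res⁻ ns t + ∏ (λ n → w (suc n) * t n) ns) + z * (V ns * Res⁻ ns t)
      ≈⟨ +-cong (trans (*-congˡ (residues ns ns≢ 0<ns)) (*-identityʳ _))
           (*-congˡ (sym (Bump.bump-V pred t ns ns≢ (All.map w!-pred 0<ns)))) ⟩
    V ns + z * bump pred V ns ∎

-- Partitions, first-column hook lengths and neighbours.

_⊑_ : ℕ → Maybe ℕ → Set
n ⊑ nothing = ⊤
n ⊑ just p = n ≤ p

⊑-trans : ∀ {m n} p → m ≤ n → n ⊑ p → m ⊑ p
⊑-trans nothing _ _ = tt
⊑-trans (just p) = ℕ.≤-trans

infixr 5 _∷_
-- The index bounds the first part, `nothing` being no bound, just as in `canInc`; induction over
-- the rows thus remembers the row above.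
data Partition : Maybe ℕ → List ℕ → Set where
  [] : ∀ {p} → Partition p []
  _∷_ : ∀ {p x xs} → suc x ⊑ p → Partition (just (suc x)) xs → Partition p (suc x ∷ xs)

-- The first-column hook lengths.
beta : List ℕ → List ℕ
beta [] = []
beta (x ∷ xs) = x ℕ.+ length xs ∷ beta xs

beta-< : ∀ {x xs} → Partition (just x) xs → All (_< x ℕ.+ length xs) (beta xs)
beta-< [] = []
beta-< {x} (_∷_ {x = y} {xs} y≤x ys) rewrite ℕ.+-suc x (length xs) =
  s≤s (ℕ.+-monoˡ-≤ (length xs) y≤x) ∷
  All.map (λ c< → ℕ.<-trans c< (s≤s (ℕ.+-monoˡ-≤ (length xs) y≤x))) (beta-< ys)

beta-≢ : ∀ {p xs} → Partition p xs → AllPairs _≢_ (beta xs)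
beta-≢ [] = []
beta-≢ (_ ∷ xs) = All.map (λ c<b → ℕ.<⇒≢ c<b ∘ ≡.sym) (beta-< xs) ∷ beta-≢ xs

beta-positive : ∀ {p xs} → Partition p xs → All (0 <_) (beta xs)
beta-positive [] = []
beta-positive (_ ∷ xs) = s≤s z≤n ∷ beta-positive xs

<ᵇ-true : ∀ {m n} → m < n → (m <ᵇ n) ≡ true
<ᵇ-true {m} {n} m<n with m <ᵇ n | ℕ.<⇒<ᵇ m<n
... | true | _ = ≡.refl

<ᵇ-irrefl : ∀ n → (n <ᵇ n) ≡ false
<ᵇ-irrefl zero = ≡.refl
<ᵇ-irrefl (suc n) = <ᵇ-irrefl n

canDec : ℕ → List ℕ → Bool
canDec x [] = true
canDec x (y ∷ ys) = y <ᵇ x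

infixr 5 _∷₀_
-- Lowering a last row of length one must delete it, since parts are positive.
_∷₀_ : ℕ → List ℕ → List ℕ
zero ∷₀ [] = []
zero ∷₀ (y ∷ ys) = zero ∷ y ∷ ys
suc x ∷₀ ys = suc x ∷ ys

module Neighbours {c ℓ} (R : CommutativeRing c ℓ) where
  open CommutativeRing R
  open Bumps R

  up : Maybe ℕ → (List ℕ → Carrier) → List ℕ → Carrier
  up p g [] = g (1 ∷ [])
  up p g (x ∷ xs) = (if canInc p x then g (suc x ∷ xs) else 0#) + up (just x) (g ∘ (x ∷_)) xs

  down : (List ℕ → Carrier) → List ℕ → Carrier
  down g [] = 0#
  down g (x ∷ xs) = (if canDec x xs then g (pred x ∷₀ xs) else 0#) + down (g ∘ (x ∷_)) xs

  -- What allows corner tests to be dropped: `vanish` removes the inadmissible summands, `trim`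
  -- identifies a partition with its extension by an empty row.
  record BoxFunction (g : List ℕ → Carrier) : Set ℓ where
    field
      vanish : ∀ pre x xs → g (pre ++ x ∷ suc x ∷ xs) ≈ 0#
      trim : ∀ xs → g (xs ++ 0 ∷ []) ≈ g xs

  open BoxFunction

  prefix : ∀ {g} → BoxFunction g → ∀ x → BoxFunction (g ∘ (x ∷_))
  vanish (prefix G x) pre = vanish G (x ∷ pre)
  trim (prefix G x) xs = trim G (x ∷ xs)

  -- A row as long as the one above may not grow, and there the summand is zero. In the recursion
  -- the row above is already built into `g`; `top` hands its vanishing down.
  up-bump : ∀ {g} → BoxFunction g → ∀ {p xs} → Partition p xs →
            (∀ q ys → p ≡ just q → g (suc q ∷ ys) ≈ 0#) →
            up p g xs ≈ bump suc g xs + g (xs ++ 1 ∷ [])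
  up-bump G [] top = sym (+-identityˡ _)
  up-bump {g} G {p} (_∷_ {x = x} {xs} x≤p ys) top = trans
    (+-cong (first p x≤p top) (up-bump (prefix G (suc x)) ys (λ { _ zs ≡.refl → vanish G [] (suc x) zs })))
    (sym (+-assoc _ _ _))
    where
    first : ∀ p → suc x ⊑ p → (∀ q ys → p ≡ just q → g (suc q ∷ ys) ≈ 0#) →
            (if canInc p (suc x) then g (suc (suc x) ∷ xs) else 0#) ≈ g (suc (suc x) ∷ xs)
    first nothing _ _ = refl
    first (just q) x≤q top with ℕ.m≤n⇒m<n∨m≡n x≤q
    ... | inj₁ x<q rewrite <ᵇ-true x<q = refl
    ... | inj₂ ≡.refl rewrite <ᵇ-irrefl x = sym (top (suc x) xs ≡.refl)

  -- A row as long as the next may not shrink: it would be one box shorter than the next, where `g`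
  -- vanishes. A last row that becomes empty is dropped by `trim`.
  down-bump : ∀ {g} → BoxFunction g → ∀ {p xs} → Partition p xs → down g xs ≈ bump pred g xs
  down-bump G [] = refl
  down-bump {g} G (_∷_ {x = x} {xs} _ ys) = +-cong (first x xs ys) (down-bump (prefix G (suc x)) ys)
    where
    first : ∀ x xs → Partition (just (suc x)) xs → (if canDec (suc x) xs then g (x ∷₀ xs) else 0#) ≈ g (x ∷ xs)
    first zero [] _ = sym (trim G [])
    first (suc x) [] _ = refl
    first x (suc y ∷ ys) (y≤x ∷ _) with ℕ.m≤n⇒m<n∨m≡n y≤x
    first (suc x) (suc y ∷ ys) _ | inj₁ y<x rewrite <ᵇ-true y<x = refl
    first zero (suc y ∷ ys) _ | inj₁ (s≤s ())
    first x (suc y ∷ ys) _ | inj₂ ≡.refl rewrite <ᵇ-irrefl x = sym (vanish G [] x ys)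

  -- A first-column hook length is the row length plus the number of rows below, and `bump`
  -- preserves that number. For `pred` the commutation with addition requires nonempty rows.
  bump-beta : ∀ f {g : List ℕ → Carrier} xs → All (λ x → ∀ n → f x ℕ.+ n ≡ f (x ℕ.+ n)) xs →
              bump f (g ∘ beta) xs ≈ bump f g (beta xs)
  bump-beta f [] [] = refl
  bump-beta f {g} (x ∷ xs) (e ∷ es) = +-cong
    (reflexive (≡.cong (λ b → g (b ∷ beta xs)) (e (length xs))))
    (trans (bump-cong-length f xs (λ cs eq → reflexive (≡.cong (λ n → g (x ℕ.+ n ∷ beta cs)) eq)))
           (bump-beta f {g ∘ (x ℕ.+ length xs ∷_)} xs es))

-- Hook products in terms of first-column hook lengths.

module HookProducts {c ℓ} {R : CommutativeRing c ℓ} (T : Tangents R) where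
  open CommutativeRing R
  open Tangents T
  open IntegerCoefficients R
  open Products R
  open Bumps R
  open Neighbours R
  open Vandermonde T
  open BoxFunction
  open import Relation.Binary.Reasoning.Setoid setoid

  G : List ℕ → Carrier
  G xs = V (beta xs)

  beta-new : ∀ k xs → beta (xs ++ k ∷ []) ≡ new k (beta xs)
  beta-new k [] = ≡.cong (_∷ []) (ℕ.+-identityʳ k)
  beta-new k (x ∷ xs) = ≡.cong₂ _∷_
    (≡.trans (≡.cong (x ℕ.+_) (≡.trans (List.length-++ xs) (ℕ.+-comm (length xs) 1))) (ℕ.+-suc x (length xs)))
    (beta-new k xs)

  -- Consecutive rows of lengths x and x + 1 have equal first-column hook lengths, so a factor
  -- `τ a a` appears.
  G-BoxFunction : BoxFunction G
  vanish G-BoxFunction [] x xs rewrite ℕ.+-suc x (length xs) =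
    trans (*-congʳ (trans (*-congˡ (trans (*-congʳ (τ-refl (x ℕ.+ length xs))) (zeroˡ _))) (zeroʳ _))) (zeroˡ _)
  vanish G-BoxFunction (y ∷ pre) x xs = trans (*-congˡ (vanish G-BoxFunction pre x xs)) (zeroʳ _)
  trim G-BoxFunction xs = trans (reflexive (≡.cong V (beta-new 0 xs))) (V-shift (beta xs))

  up-G : ∀ {xs} → Partition nothing xs → up nothing G xs ≈ bump suc V (beta xs) + V (new 1 (beta xs))
  up-G {xs} ys = trans (up-bump G-BoxFunction ys (λ _ _ ()))
    (+-cong (bump-beta suc {V} xs (All.universal (λ _ _ → ≡.refl) xs)) (reflexive (≡.cong V (beta-new 1 xs))))

  down-G : ∀ {p xs} → Partition p xs → down G xs ≈ bump pred V (beta xs)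
  down-G {p} {xs} ys = trans (down-bump G-BoxFunction ys) (bump-beta pred {V} xs (predecessors ys))
    where
    predecessors : ∀ {p xs} → Partition p xs → All (λ x → ∀ n → pred x ℕ.+ n ≡ pred (x ℕ.+ n)) xs
    predecessors [] = []
    predecessors (_ ∷ ys) = (λ _ → ≡.refl) ∷ predecessors ys

  ∏< : ℕ → (ℕ → Carrier) → Carrier
  ∏< zero f = 1#
  ∏< (suc n) f = f 0 * ∏< n (f ∘ suc)

  ∏<-cong : ∀ n {f g} → (∀ {j} → j < n → f j ≈ g j) → ∏< n f ≈ ∏< n g
  ∏<-cong zero e = refl
  ∏<-cong (suc n) e = *-cong (e (s≤s z≤n)) (∏<-cong n (e ∘ s≤s))

  ∏<-+ : ∀ m n f → ∏< (m ℕ.+ n) f ≈ ∏< m f * ∏< n (f ∘ (m ℕ.+_))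
  ∏<-+ zero n f = sym (*-identityˡ _)
  ∏<-+ (suc m) n f = trans (*-congˡ (∏<-+ m n (f ∘ suc))) (sym (*-assoc _ _ _))

  ∏<-suc : ∀ n f → ∏< (suc n) f ≈ f n * ∏< n f
  ∏<-suc zero f = refl
  ∏<-suc (suc n) f = trans (*-congˡ (∏<-suc n (f ∘ suc)))
    (solve 3 (λ x y z → x :* (y :* z) := y :* (x :* z)) refl _ _ _)

  ∏<-reverse : ∀ n f → ∏< n (λ j → f (n ∸ suc j)) ≈ ∏< n f
  ∏<-reverse zero f = refl
  ∏<-reverse (suc n) f = trans (*-congˡ (∏<-reverse n f)) (sym (∏<-suc n f))

  ∏-applyUpTo : ∀ (f : ℕ → Carrier) (h : ℕ → ℕ) n → ∏ f (applyUpTo h n) ≡ ∏< n (f ∘ h)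
  ∏-applyUpTo f h zero = ≡.refl
  ∏-applyUpTo f h (suc n) = ≡.cong (f (h 0) *_) (∏-applyUpTo f (h ∘ suc) n)

  w!-∏< : ∀ n → ∏< n (w ∘ suc) ≈ w! n
  w!-∏< zero = refl
  w!-∏< (suc n) = trans (∏<-suc n (w ∘ suc)) (*-congˡ (w!-∏< n))

  column-accept : ∀ {x j} xs → j < x → column (x ∷ xs) j ≡ suc (column xs j)
  column-accept {x} {j} xs j<x = ≡.cong length (List.filter-accept (j ℕ.<?_) {x} {xs} j<x)

  column-outside : ∀ {x j xs} → Partition (just x) xs → x ≤ j → column xs j ≡ 0
  column-outside [] _ = ≡.refl
  column-outside {j = j} (_∷_ {x = y} {xs} y≤x ys) x≤j = ≡.trans
    (≡.cong length (List.filter-reject (j ℕ.<?_) {suc y} {xs} (ℕ.≤⇒≯ (ℕ.≤-trans y≤x x≤j))))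
    (column-outside ys (ℕ.≤-trans y≤x x≤j))

  -- The hook lengths of a row of length x and the differences of its
  -- first-column hook length b with the later ones are complementary in {1,…,b}.
  row-complement : ∀ (f : ℕ → Carrier) {x xs} → Partition (just x) xs →
    ∏< x (λ j → f ((x ∸ suc j) ℕ.+ column xs j)) * ∏ (λ c → f ((x ℕ.+ length xs) ∸ suc c)) (beta xs)
      ≈ ∏< (x ℕ.+ length xs) f
  row-complement f {x} [] = trans (*-identityʳ _) (trans
    (trans (∏<-cong x (λ _ → reflexive (≡.cong f (ℕ.+-identityʳ _)))) (∏<-reverse x f))
    (reflexive (≡.cong (λ n → ∏< n f) (≡.sym (ℕ.+-identityʳ x)))))
  row-complement f {x} (_∷_ {x = y₀} {xs} y≤x ys) with ℕ.m≤n⇒∃[o]m+o≡n y≤x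
  ... | (d , ≡.refl) = begin
    ∏< (y ℕ.+ d) row * (f ((y ℕ.+ d ℕ.+ suc n) ∸ suc b) * ∏ (λ c → f ((y ℕ.+ d ℕ.+ suc n) ∸ suc c)) (beta xs))
      -- The row exceeds the next one by `d` boxes. The overhanging boxes have no leg and supply the
      -- arguments below `d`, the next row's first-column hook length supplies `d` itself, and
      -- everything else is the induction hypothesis shifted by `d + 1`.
      ≈⟨ *-cong (trans (∏<-+ y d row) (*-cong (∏<-cong y inside) (trans (∏<-cong d outside) (∏<-reverse d f))))
           (*-cong (reflexive (≡.cong f corner)) (∏-cong (All.map later (beta-< ys)))) ⟩
    ∏< y (λ j → f (suc d ℕ.+ ((y ∸ suc j) ℕ.+ column xs j))) * ∏< d f * (f d * ∏ (λ c → f (suc d ℕ.+ (b ∸ suc c))) (beta xs))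
      ≈⟨ solve 4 (λ p q r s → p :* q :* (r :* s) := r :* q :* (p :* s)) refl _ _ _ _ ⟩
    f d * ∏< d f * (∏< y (λ j → f (suc d ℕ.+ ((y ∸ suc j) ℕ.+ column xs j))) * ∏ (λ c → f (suc d ℕ.+ (b ∸ suc c))) (beta xs))
      ≈⟨ *-cong (sym (∏<-suc d f)) (row-complement (f ∘ (suc d ℕ.+_)) ys) ⟩
    ∏< (suc d) f * ∏< b (f ∘ (suc d ℕ.+_))
      ≈⟨ ∏<-+ (suc d) b f ⟨
    ∏< (suc d ℕ.+ b) f
      ≡⟨ ≡.cong (λ k → ∏< k f) total ⟨
    ∏< (y ℕ.+ d ℕ.+ suc n) f ∎
    where
    y = suc y₀
    n = length xs
    b = y ℕ.+ n
    row : ℕ → Carrier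
    row j = f ((y ℕ.+ d ∸ suc j) ℕ.+ column (y ∷ xs) j)
    total : y ℕ.+ d ℕ.+ suc n ≡ suc d ℕ.+ b
    total = ≡.trans (ℕ.+-suc (y ℕ.+ d) n) (≡.cong suc (≡.trans (≡.cong (ℕ._+ n) (ℕ.+-comm y d)) (ℕ.+-assoc d y n)))
    corner : (y ℕ.+ d ℕ.+ suc n) ∸ suc b ≡ d
    corner = ≡.trans (≡.cong (_∸ suc b) total) (ℕ.m+n∸n≡m d b)
    later : ∀ {c} → c < b → f ((y ℕ.+ d ℕ.+ suc n) ∸ suc c) ≈ f (suc d ℕ.+ (b ∸ suc c))
    later {c} c<b = reflexive (≡.cong f (≡.trans (≡.cong (_∸ suc c) total) (ℕ.+-∸-assoc (suc d) c<b)))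
    inside : ∀ {j} → j < y → row j ≈ f (suc d ℕ.+ ((y ∸ suc j) ℕ.+ column xs j))
    inside {j} j<y = reflexive (≡.cong f (≡.trans
      (≡.cong₂ ℕ._+_ (≡.trans (≡.cong (_∸ suc j) (ℕ.+-comm y d)) (ℕ.+-∸-assoc d j<y)) (column-accept xs j<y))
      (≡.trans (ℕ.+-suc _ (column xs j)) (≡.cong suc (ℕ.+-assoc d (y ∸ suc j) (column xs j))))))
    outside : ∀ {i} → i < d → row (y ℕ.+ i) ≈ f (d ∸ suc i)
    outside {i} i<d = reflexive (≡.cong f (≡.trans
      (≡.cong₂ ℕ._+_ (≡.trans (≡.cong (y ℕ.+ d ∸_) (≡.sym (ℕ.+-suc y i))) (ℕ.[m+n]∸[m+o]≡n∸o y d (suc i)))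
        (column-outside {xs = y ∷ xs} (ℕ.≤-refl ∷ ys) (ℕ.m≤m+n y i)))
      (ℕ.+-identityʳ _)))

  W-∸ : ∀ {b c} → c < b → w (suc (b ∸ suc c)) ≡ W b c
  W-∸ {suc b} {zero} _ = ≡.refl
  W-∸ {suc b} {suc c} (s≤s c<b) = W-∸ c<b

  -- The complementary factors `W b c` are removed by multiplying with their inverses `τ b c`.
  row-product : ∀ {x xs} → Partition (just x) xs →
    ∏< x (λ j → w (suc ((x ∸ suc j) ℕ.+ column xs j))) ≈ w! (x ℕ.+ length xs) * ∏ (τ (x ℕ.+ length xs)) (beta xs)
  row-product {x} {xs} ys = begin
    row                                   ≈⟨ *-identityʳ row ⟨
    row * 1#                              ≈⟨ *-congˡ (inverse (beta xs) (beta-< ys)) ⟨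
    row * (∏ (λ c → w (suc (b ∸ suc c))) (beta xs) * ∏ (τ b) (beta xs)) ≈⟨ *-assoc _ _ _ ⟨
    row * ∏ (λ c → w (suc (b ∸ suc c))) (beta xs) * ∏ (τ b) (beta xs)   ≈⟨ *-congʳ (trans (row-complement (w ∘ suc) ys) (w!-∏< b)) ⟩
    w! b * ∏ (τ b) (beta xs)              ∎
    where
    b = x ℕ.+ length xs
    row = ∏< x (λ j → w (suc ((x ∸ suc j) ℕ.+ column xs j)))
    inverse : ∀ cs → All (_< b) cs → ∏ (λ c → w (suc (b ∸ suc c))) cs * ∏ (τ b) cs ≈ 1#
    inverse [] [] = *-identityˡ 1#
    inverse (c ∷ cs) (c<b ∷ cs<b) = trans
      (solve 4 (λ x y z t → x :* y :* (z :* t) := (x :* z) :* (y :* t)) refl _ _ _ _)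
      (trans (*-cong (trans (*-congʳ (reflexive (W-∸ c<b))) (W*τ (ℕ.<⇒≢ c<b ∘ ≡.sym))) (inverse cs cs<b)) (*-identityˡ 1#))

  ∏-++ : ∀ (f : ℕ → Carrier) xs ys → ∏ f (xs ++ ys) ≈ ∏ f xs * ∏ f ys
  ∏-++ f [] ys = sym (*-identityˡ _)
  ∏-++ f (x ∷ xs) ys = trans (*-congˡ (∏-++ f xs ys)) (sym (*-assoc _ _ _))

  -- The `i` rows already passed reach at least as far as the bound `p`, so within that width each
  -- of them adds one box to every column.
  ∏-hooksFrom : ∀ i full {p xs} → Partition p xs → (∀ j → suc j ⊑ p → column full j ≡ i ℕ.+ column xs j) →
                ∏ w (hooksFrom i full xs) ≈ G xs
  ∏-hooksFrom i full [] _ = refl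
  ∏-hooksFrom i full {p} (_∷_ {x = x₀} {xs} x≤p ys) columns = begin
    ∏ w (applyUpTo hook x ++ hooksFrom (suc i) full xs)
      ≈⟨ ∏-++ w (applyUpTo hook x) _ ⟩
    ∏ w (applyUpTo hook x) * ∏ w (hooksFrom (suc i) full xs)
      ≈⟨ *-cong (trans (reflexive (∏-applyUpTo w hook x)) (∏<-cong x hook-≡)) (∏-hooksFrom (suc i) full ys (λ j j<x → column-≡ j<x)) ⟩
    ∏< x (λ j → w (suc ((x ∸ suc j) ℕ.+ column xs j))) * G xs
      ≈⟨ *-congʳ (row-product ys) ⟩
    G (x ∷ xs) ∎
    where
    x = suc x₀
    hook : ℕ → ℕ
    hook j = suc ((x ∸ suc j) ℕ.+ (column full j ∸ suc i))
    column-≡ : ∀ {j} → j < x → column full j ≡ suc i ℕ.+ column xs j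
    column-≡ {j} j<x = ≡.trans (columns j (⊑-trans p j<x x≤p)) (≡.trans (≡.cong (i ℕ.+_) (column-accept xs j<x)) (ℕ.+-suc i _))
    hook-≡ : ∀ {j} → j < x → w (hook j) ≈ w (suc ((x ∸ suc j) ℕ.+ column xs j))
    hook-≡ {j} j<x = reflexive (≡.cong (λ k → w (suc ((x ∸ suc j) ℕ.+ k)))
      (≡.trans (≡.cong (_∸ suc i) (column-≡ j<x)) (ℕ.m+n∸m≡n (suc i) _)))

  ∏-hooks : ∀ {xs} → Partition nothing xs → ∏ w (hooks xs) ≈ G xs
  ∏-hooks {xs} ys = ∏-hooksFrom 0 xs ys (λ _ _ → ≡.refl)

-- The growth identity for partitions, and the linear case.

module HookGrowth {c ℓ} {R : CommutativeRing c ℓ} {T : Tangents R} (A : AdditionLaw T) where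
  open CommutativeRing R
  open AdditionLaw A using (z)
  open Bumps R
  open Neighbours R
  open Vandermonde T
  open HookProducts T
  open import Relation.Binary.Reasoning.Setoid setoid

  growth : ∀ {xs} → Partition nothing xs → up nothing G xs ≈ G xs + z * down G xs
  growth {xs} ys = begin
    up nothing G xs                                    ≈⟨ up-G ys ⟩
    bump suc V (beta xs) + V (new 1 (beta xs))         ≈⟨ Growth.V-growth A (beta xs) (beta-≢ ys) (beta-positive ys) ⟩
    V (beta xs) + z * bump pred V (beta xs)            ≈⟨ +-congˡ (*-congˡ (down-G ys)) ⟨
    G xs + z * down G xs                               ∎

-- The case z = 0, where t n = n.
module LinearTangents {c ℓ} {R : CommutativeRing c ℓ} (T : Tangents R) where
  open CommutativeRing R
  open Tangents T
  open IntegerCoefficients R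
  open Products R
  open Bumps R
  open Neighbours R
  open Vandermonde T
  open HookProducts T
  open import Algebra.Properties.Group +-group using (ε⁻¹≈ε; ∙-cancelʳ)
  open import Relation.Binary.Reasoning.Setoid setoid

  module _ (t-suc : ∀ n → t (suc n) ≈ 1# + t n) where
    τ-difference : ∀ m n → τ m n ≈ t m - t n
    τ-difference m zero = sym (trans (+-congˡ (trans (-‿cong t-0) ε⁻¹≈ε)) (+-identityʳ _))
    τ-difference zero (suc n) = sym (trans (+-congʳ t-0) (+-identityˡ _))
    τ-difference (suc m) (suc n) = begin
      τ m n                        ≈⟨ τ-difference m n ⟩
      t m - t n                    ≈⟨ solve 2 (λ x y → x :- y := (:1 :+ x) :- (:1 :+ y)) refl _ _ ⟩
      (1# + t m) - (1# + t n)      ≈⟨ +-cong (t-suc m) (-‿cong (t-suc n)) ⟨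
      t (suc m) - t (suc n)        ∎

    τ-pred : ∀ {m} n → 0 < m → τ (pred m) n ≈ τ m n - 1#
    τ-pred {suc m} n _ = begin
      τ m n                      ≈⟨ τ-difference m n ⟩
      t m - t n                  ≈⟨ solve 2 (λ x y → x :- y := (:1 :+ x) :- y :- :1) refl _ _ ⟩
      (1# + t m) - t n - 1#      ≈⟨ +-congʳ (+-congʳ (t-suc m)) ⟨
      t (suc m) - t n - 1#       ≈⟨ +-congʳ (τ-difference (suc m) n) ⟨
      τ (suc m) n - 1#           ∎

    W-mul : ∀ {x m n} → x ≢ m → x ≢ n → m ≢ n → W x m * W x n ≈ W m n * (W x m - W x n)
    W-mul {x} {m} {n} x≢m x≢n m≢n = begin
      W x m * W x n
        ≈⟨ *-identityʳ _ ⟨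
      W x m * W x n * 1#
        ≈⟨ *-congˡ (W*τ m≢n) ⟨
      W x m * W x n * (W m n * τ m n)
        ≈⟨ *-congˡ (*-congˡ chasles) ⟩
      W x m * W x n * (W m n * (τ x n - τ x m))
        ≈⟨ solve 5 (λ X Y Z p q → X :* Y :* (Z :* (q :- p)) := Z :* (X :* (Y :* q) :- Y :* (X :* p))) refl _ _ _ _ _ ⟩
      W m n * (W x m * (W x n * τ x n) - W x n * (W x m * τ x m))
        ≈⟨ *-congˡ (+-cong (trans (*-congˡ (W*τ x≢n)) (*-identityʳ _)) (-‿cong (trans (*-congˡ (W*τ x≢m)) (*-identityʳ _)))) ⟩
      W m n * (W x m - W x n) ∎
      where
      chasles : τ m n ≈ τ x n - τ x m
      chasles = begin
        τ m n                          ≈⟨ τ-difference m n ⟩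
        t m - t n                      ≈⟨ solve 3 (λ x y z → y :- z := (x :- z) :- (x :- y)) refl (t x) _ _ ⟩
        (t x - t n) - (t x - t m)      ≈⟨ +-cong (τ-difference x n) (-‿cong (τ-difference x m)) ⟨
        τ x n - τ x m                  ∎

    open RationalKernel R ℕ W t _≢_ using () renaming (v to v₁; Res-1-∷ to sum-1; Res-pos-∷ to sum-t)
    open Residues R ℕ v₁ using (Res)
    open Residues R ℕ (v pred) using () renaming (Res to Res⁻; Res-cong to Res⁻-cong)

    v-pred : ∀ {m n} → 0 < m → m ≢ n → v pred m n ≈ v₁ m n
    v-pred {m} {n} 0<m m≢n = begin
      W m n * τ (pred m) n         ≈⟨ *-congˡ (τ-pred n 0<m) ⟩
      W m n * (τ m n - 1#)         ≈⟨ solve 2 (λ x y → x :* (y :- :1) := x :* y :- x) refl _ _ ⟩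
      W m n * τ m n - W m n        ≈⟨ +-congʳ (W*τ m≢n) ⟩
      1# - W m n                   ∎

    Res⁻≈Res : ∀ ns Φ → AllPairs _≢_ ns → All (0 <_) ns → Res⁻ ns Φ ≈ Res ns Φ
    Res⁻≈Res [] Φ _ _ = refl
    Res⁻≈Res (n ∷ ns) Φ (n≢ ∷ ns≢) (0<n ∷ 0<ns) = +-cong
      (*-congˡ (∏-cong (All.map (v-pred 0<n) n≢)))
      (trans (Res⁻-cong (All.zipWith (λ { (n≢m , 0<m) → *-congˡ (v-pred 0<m (n≢m ∘ ≡.sym)) }) (n≢ , 0<ns)))
             (Res⁻≈Res ns _ ns≢ 0<ns))

    t-+ : ∀ m n → t (m ℕ.+ n) ≈ t m + t n
    t-+ zero n = sym (trans (+-congʳ t-0) (+-identityˡ _))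
    t-+ (suc m) n = trans (t-suc _) (trans (+-congˡ (t-+ m n)) (trans (sym (+-assoc _ _ _)) (+-congʳ (sym (t-suc m)))))

    W-t : ∀ {m n} → m ≢ n → W m n * (t m - t n) ≈ 1#
    W-t {m} {n} m≢n = trans (*-congˡ (sym (τ-difference m n))) (W*τ m≢n)

    Res-beta-1 : ∀ {p xs} → Partition p xs → Res (beta xs) (λ _ → 1#) ≈ t (length xs)
    Res-beta-1 [] = sym t-0
    Res-beta-1 {p} {x ∷ xs} π@(_ ∷ ys) = trans (sum-1 W-anti W-mul W-t _ (beta xs) (beta-≢ π))
      (trans (+-congˡ (Res-beta-1 ys)) (sym (t-suc _)))

    -- Each step of `sum-t` subtracts the number of rows below, exactly the excess of the
    -- first-column hook length over the row length.
    Res-beta-t : ∀ {p xs} → Partition p xs → Res (beta xs) t ≈ t (size xs)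
    Res-beta-t [] = sym t-0
    Res-beta-t {p} {x ∷ xs} π@(_ ∷ ys) = ∙-cancelʳ (t (length xs)) _ _ (begin
      Res (beta (x ∷ xs)) t + t (length xs)
        ≈⟨ +-congˡ (Res-beta-1 ys) ⟨
      Res (beta (x ∷ xs)) t + Res (beta xs) (λ _ → 1#)
        ≈⟨ sum-t W-anti W-mul W-t _ (beta xs) (beta-≢ π) ⟩
      t (x ℕ.+ length xs) + Res (beta xs) t
        ≈⟨ +-cong (t-+ x (length xs)) (Res-beta-t ys) ⟩
      (t x + t (length xs)) + t (size xs)
        ≈⟨ solve 3 (λ x y z → (x :+ y) :+ z := (x :+ z) :+ y) refl _ _ _ ⟩
      (t x + t (size xs)) + t (length xs)
        ≈⟨ +-congʳ (t-+ x (size xs)) ⟨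
      t (size (x ∷ xs)) + t (length xs) ∎)

    down-size : ∀ {p xs} → Partition p xs → down G xs ≈ G xs * t (size xs)
    down-size {p} {xs} ys = begin
      down G xs                        ≈⟨ down-G ys ⟩
      bump pred V (beta xs)            ≈⟨ Bump.bump-V pred t (beta xs) (beta-≢ ys) (All.map w!-pred (beta-positive ys)) ⟩
      G xs * Res⁻ (beta xs) t          ≈⟨ *-congˡ (trans (Res⁻≈Res (beta xs) t (beta-≢ ys) (beta-positive ys)) (Res-beta-t ys)) ⟩
      G xs * t (size xs)               ∎

-- The commutation relation on Young's lattice.

partition-weaken : ∀ {x y xs} → x ≤ y → Partition (just x) xs → Partition (just y) xs
partition-weaken x≤y [] = []
partition-weaken x≤y (z≤x ∷ zs) = ℕ.≤-trans z≤x x≤y ∷ zs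

canInc-⊑ : ∀ p {x} → canInc p x ≡ true → suc x ⊑ p
canInc-⊑ nothing _ = tt
canInc-⊑ (just p) {x} e = ℕ.<ᵇ⇒< x p (≡.subst T (≡.sym e) tt)

⊑-canInc : ∀ p {x} → suc x ⊑ p → canInc p x ≡ true
⊑-canInc nothing _ = ≡.refl
⊑-canInc (just p) = <ᵇ-true

partition-lower : ∀ {p} x {xs} → x ⊑ p → Partition (just (suc x)) xs → canDec (suc x) xs ≡ true → Partition p (x ∷₀ xs)
partition-lower zero {[]} _ _ _ = []
partition-lower (suc x) {[]} x⊑p _ _ = x⊑p ∷ []
partition-lower x {suc y ∷ ys} x⊑p (_ ∷ ys′) e with ℕ.<ᵇ⇒< (suc y) (suc x) (≡.subst T (≡.sym e) tt)
partition-lower (suc x) {suc y ∷ ys} x⊑p (_ ∷ ys′) e | s≤s y≤x = x⊑p ∷ y≤x ∷ ys′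

module YoungLattice {c ℓ} (R : CommutativeRing c ℓ) where
  open CommutativeRing R
  open IntegerCoefficients R
  open Neighbours R
  open import Relation.Binary.Reasoning.Setoid setoid

  if-cong : ∀ b {x y} → (b ≡ true → x ≈ y) → (if b then x else 0#) ≈ (if b then y else 0#)
  if-cong true e = e ≡.refl
  if-cong false _ = refl

  if-+ : ∀ b {x y} → (if b then x + y else 0#) ≈ (if b then x else 0#) + (if b then y else 0#)
  if-+ true = refl
  if-+ false = sym (+-identityˡ 0#)

  if-* : ∀ b k {x} → (if b then k * x else 0#) ≈ k * (if b then x else 0#)
  if-* true k = refl
  if-* false k = sym (zeroʳ k)

  up-cong : ∀ {p g h xs} → 1 ⊑ p → Partition p xs → (∀ {ν} → Partition p ν → g ν ≈ h ν) → up p g xs ≈ up p h xs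
  up-cong 1⊑p [] e = e (1⊑p ∷ [])
  up-cong {p} 1⊑p (x⊑p ∷ xs) e = +-cong
    (if-cong (canInc p _) (λ inc → e (canInc-⊑ p inc ∷ partition-weaken (ℕ.n≤1+n _) xs)))
    (up-cong (s≤s z≤n) xs (λ ν → e (x⊑p ∷ ν)))

  down-cong : ∀ {p g h xs} → Partition p xs → (∀ {ν} → Partition p ν → g ν ≈ h ν) → down g xs ≈ down h xs
  down-cong [] e = refl
  down-cong {p} (_∷_ {x = x} {xs} x⊑p ys) e = +-cong
    (if-cong (canDec (suc x) xs) (λ dec → e (partition-lower x (⊑-trans p (ℕ.n≤1+n x) x⊑p) ys dec)))
    (down-cong ys (λ ν → e (x⊑p ∷ ν)))

  up-+ : ∀ p g h xs → up p (λ ν → g ν + h ν) xs ≈ up p g xs + up p h xs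
  up-+ p g h [] = refl
  up-+ p g h (x ∷ xs) = trans (+-cong (if-+ (canInc p x)) (up-+ (just x) _ _ xs))
    (solve 4 (λ a b c d → (a :+ b) :+ (c :+ d) := (a :+ c) :+ (b :+ d)) refl _ _ _ _)

  down-+ : ∀ g h xs → down (λ ν → g ν + h ν) xs ≈ down g xs + down h xs
  down-+ g h [] = sym (+-identityˡ 0#)
  down-+ g h (x ∷ xs) = trans (+-cong (if-+ (canDec x xs)) (down-+ _ _ xs))
    (solve 4 (λ a b c d → (a :+ b) :+ (c :+ d) := (a :+ c) :+ (b :+ d)) refl _ _ _ _)

  up-* : ∀ p k g xs → up p (λ ν → k * g ν) xs ≈ k * up p g xs
  up-* p k g [] = refl
  up-* p k g (x ∷ xs) = trans (+-cong (if-* (canInc p x) k) (up-* (just x) k _ xs)) (sym (distribˡ k _ _))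

  down-* : ∀ k g xs → down (λ ν → k * g ν) xs ≈ k * down g xs
  down-* k g [] = sym (zeroʳ k)
  down-* k g (x ∷ xs) = trans (+-cong (if-* (canDec x xs) k) (down-* k _ xs)) (sym (distribˡ k _ _))

  if-0 : ∀ b → (if b then 0# else 0#) ≈ 0#
  if-0 true = refl
  if-0 false = refl

  up-0 : ∀ p xs → up p (λ _ → 0#) xs ≈ 0#
  up-0 p [] = refl
  up-0 p (x ∷ xs) = trans (+-cong (if-0 (canInc p x)) (up-0 (just x) xs)) (+-identityˡ 0#)

  down-0 : ∀ xs → down (λ _ → 0#) xs ≈ 0#
  down-0 [] = refl
  down-0 (x ∷ xs) = trans (+-cong (if-0 (canDec x xs)) (down-0 xs)) (+-identityˡ 0#)

  growable : Maybe ℕ → List ℕ → Bool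
  growable p [] = true
  growable p (x ∷ xs) = canInc p x

  canDec-suc : ∀ {x xs} → Partition (just x) xs → canDec (suc x) xs ≡ true
  canDec-suc [] = ≡.refl
  canDec-suc (y≤x ∷ _) = <ᵇ-true (s≤s y≤x)

  -- The first row is lowered after, respectively before, a box is added. Only the second order can
  -- put the removed box back; this is possible when the next row is shorter, which is also the
  -- condition for `xs` to be growable under the bound `suc x`.
  lower-up : ∀ {p} x {xs} g → suc x ⊑ p → Partition (just (suc x)) xs →
    up (just (suc x)) (λ ν → if canDec (suc x) ν then g (x ∷₀ ν) else 0#) xs
      + (if growable (just (suc x)) xs then g (suc x ∷ xs) else 0#)
    ≈ (if canDec (suc x) xs then up p g (x ∷₀ xs) else 0#)
  lower-up zero g x⊑p [] = +-identityˡ _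
  lower-up {p} (suc x) g x⊑p [] rewrite ⊑-canInc p x⊑p = +-comm _ _
  lower-up x g x⊑p (_∷_ {x = y} {ys} y≤x _) with ℕ.m≤n⇒m<n∨m≡n y≤x
  lower-up x g x⊑p (_∷_ {x = y} {ys} y≤x _) | inj₂ ≡.refl rewrite <ᵇ-irrefl x =
    trans (+-identityʳ _) (trans (+-identityˡ _) (up-0 (just (suc x)) ys))
  lower-up zero g x⊑p (_∷_ {x = y} {ys} y≤x _) | inj₁ (s≤s ())
  lower-up {p} (suc x) g x⊑p (_∷_ {x = y} {ys} y≤x _) | inj₁ y<x
    rewrite <ᵇ-true y<x | ⊑-canInc p x⊑p = +-comm _ _

  -- Moves in different places commute, and the multiplicity left over is the number of addable
  -- minus removable corners. Without a bound this is 1; a first row that has reached the bound `p`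
  -- loses its addable corner, which gives 0.
  up-down : ∀ {p xs} g → 1 ⊑ p → Partition p xs →
            up p (down g) xs ≈ down (up p g) xs + (if growable p xs then g xs else 0#)
  up-down g _ [] = +-comm _ _
  up-down {p} g 1⊑p (_∷_ {x = x} {xs} x⊑p ys) = begin
    (if i then (if canDec (suc (suc x)) xs then g (suc x ∷ xs) else 0#) + A else 0#)
      + up (just (suc x)) (λ ν → (if canDec (suc x) ν then g (x ∷₀ ν) else 0#) + down (g ∘ (suc x ∷_)) ν) xs
      ≈⟨ +-cong first (up-+ (just (suc x)) _ _ xs) ⟩
    (if i then G else 0#) + (if i then A else 0#) + (B + up (just (suc x)) (down (g ∘ (suc x ∷_))) xs)
      ≈⟨ +-congˡ (+-congˡ (up-down (g ∘ (suc x ∷_)) (s≤s z≤n) ys)) ⟩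
    (if i then G else 0#) + (if i then A else 0#) + (B + (E + (if growable (just (suc x)) xs then G else 0#)))
      ≈⟨ solve 5 (λ g a b e f → (g :+ a) :+ (b :+ (e :+ f)) := ((b :+ f) :+ (a :+ e)) :+ g) refl _ _ _ _ _ ⟩
    ((B + (if growable (just (suc x)) xs then G else 0#)) + ((if i then A else 0#) + E)) + (if i then G else 0#)
      -- The leftover of the rows below pays for the box removed from the first row and put back, so
      -- only the leftover of the first row remains.
      ≈⟨ +-congʳ (+-cong (lower-up x g x⊑p ys) (+-congʳ (if-down i))) ⟩
    ((if canDec (suc x) xs then up p g (x ∷₀ xs) else 0#)
      + (down (λ κ → if i then g (suc (suc x) ∷ κ) else 0#) xs + E)) + (if i then G else 0#)
      ≈⟨ +-congʳ (+-congˡ (down-+ _ _ xs)) ⟨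
    ((if canDec (suc x) xs then up p g (x ∷₀ xs) else 0#)
      + down (λ κ → (if i then g (suc (suc x) ∷ κ) else 0#) + up (just (suc x)) (g ∘ (suc x ∷_)) κ) xs)
      + (if i then G else 0#) ∎
    where
    i = canInc p (suc x)
    G = g (suc x ∷ xs)
    A = down (g ∘ (suc (suc x) ∷_)) xs
    B = up (just (suc x)) (λ ν → if canDec (suc x) ν then g (x ∷₀ ν) else 0#) xs
    E = down (up (just (suc x)) (g ∘ (suc x ∷_))) xs
    first : (if i then (if canDec (suc (suc x)) xs then g (suc x ∷ xs) else 0#) + A else 0#)
            ≈ (if i then G else 0#) + (if i then A else 0#)
    first rewrite canDec-suc ys = if-+ i
    if-down : ∀ b → (if b then A else 0#) ≈ down (λ κ → if b then g (suc (suc x) ∷ κ) else 0#) xs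
    if-down true = refl
    if-down false = sym (down-0 xs)

-- Formal power series over ℚ and the series ρ(h,z).

module PowerSeries where
  open import Data.Rational using (_+_; _*_; _-_; -_)
  open ≡ using (refl; sym; trans; cong; cong₂)

  toℚᵘ-ℕ→ℚ : ∀ n → toℚᵘ (ℕ→ℚ n) ℚᵘ.≃ mkℚᵘ (ℤ.+ n) 0
  toℚᵘ-ℕ→ℚ n = ℚ.toℚᵘ-fromℚᵘ (mkℚᵘ (ℤ.+ n) 0)

  ℕ→ℚ-+ : ∀ m n → ℕ→ℚ (m ℕ.+ n) ≡ ℕ→ℚ m + ℕ→ℚ n
  ℕ→ℚ-+ m n = ℚ.toℚᵘ-injective (begin
    toℚᵘ (ℕ→ℚ (m ℕ.+ n))                 ≈⟨ toℚᵘ-ℕ→ℚ (m ℕ.+ n) ⟩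
    mkℚᵘ (ℤ.+ (m ℕ.+ n)) 0                 ≈⟨ *≡* (cong (ℤ._* ℤ.+ 1) (trans (ℤ.pos-+ m n) (sym (cong₂ ℤ._+_ (ℤ.*-identityʳ (ℤ.+ m)) (ℤ.*-identityʳ (ℤ.+ n)))))) ⟩
    mkℚᵘ (ℤ.+ m) 0 ℚᵘ.+ mkℚᵘ (ℤ.+ n) 0       ≈⟨ ℚᵘ.+-cong (toℚᵘ-ℕ→ℚ m) (toℚᵘ-ℕ→ℚ n) ⟨
    toℚᵘ (ℕ→ℚ m) ℚᵘ.+ toℚᵘ (ℕ→ℚ n)       ≈⟨ ℚ.toℚᵘ-homo-+ (ℕ→ℚ m) (ℕ→ℚ n) ⟨
    toℚᵘ (ℕ→ℚ m + ℕ→ℚ n)                 ∎)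
    where open import Relation.Binary.Reasoning.Setoid ℚᵘ.≃-setoid

  ℕ→ℚ-* : ∀ m n → ℕ→ℚ (m ℕ.* n) ≡ ℕ→ℚ m * ℕ→ℚ n
  ℕ→ℚ-* m n = ℚ.toℚᵘ-injective (begin
    toℚᵘ (ℕ→ℚ (m ℕ.* n))                 ≈⟨ toℚᵘ-ℕ→ℚ (m ℕ.* n) ⟩
    mkℚᵘ (ℤ.+ (m ℕ.* n)) 0                 ≈⟨ *≡* (cong (ℤ._* ℤ.+ 1) (ℤ.pos-* m n)) ⟩
    mkℚᵘ (ℤ.+ m) 0 ℚᵘ.* mkℚᵘ (ℤ.+ n) 0       ≈⟨ ℚᵘ.*-cong (toℚᵘ-ℕ→ℚ m) (toℚᵘ-ℕ→ℚ n) ⟨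
    toℚᵘ (ℕ→ℚ m) ℚᵘ.* toℚᵘ (ℕ→ℚ n)       ≈⟨ ℚ.toℚᵘ-homo-* (ℕ→ℚ m) (ℕ→ℚ n) ⟨
    toℚᵘ (ℕ→ℚ m * ℕ→ℚ n)                 ∎)
    where open import Relation.Binary.Reasoning.Setoid ℚᵘ.≃-setoid

  inv-suc : ∀ n → inv (suc n) * ℕ→ℚ (suc n) ≡ 1ℚ
  inv-suc n = ℚ.toℚᵘ-injective (begin
    toℚᵘ (inv (suc n) * ℕ→ℚ (suc n))            ≈⟨ ℚ.toℚᵘ-homo-* (inv (suc n)) (ℕ→ℚ (suc n)) ⟩
    toℚᵘ (inv (suc n)) ℚᵘ.* toℚᵘ (ℕ→ℚ (suc n))  ≈⟨ ℚᵘ.*-cong (ℚ.toℚᵘ-fromℚᵘ (mkℚᵘ (ℤ.+ 1) n)) (toℚᵘ-ℕ→ℚ (suc n)) ⟩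
    mkℚᵘ (ℤ.+ 1) n ℚᵘ.* mkℚᵘ (ℤ.+ suc n) 0          ≈⟨ *≡* (trans (ℤ.*-identityʳ (ℤ.+ 1 ℤ.* ℤ.+ suc n)) (cong (λ k → ℤ.+ 1 ℤ.* ℤ.+ suc k) (sym (ℕ.*-identityʳ n)))) ⟩
    mkℚᵘ (ℤ.+ 1) 0                                ∎)
    where open import Relation.Binary.Reasoning.Setoid ℚᵘ.≃-setoid

  module ℚSolver = IntegerCoefficients ℚ.+-*-commutativeRing
  open ℚSolver

  inv-* : ∀ m n → inv (m ℕ.* n) ≡ inv m * inv n
  inv-* zero n = sym (ℚ.*-zeroˡ (inv n))
  inv-* (suc m) zero rewrite ℕ.*-zeroʳ m = sym (ℚ.*-zeroʳ (inv (suc m)))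
  inv-* (suc m) (suc n) = begin
    i                                             ≡⟨ solve 1 (λ i → i := i :* (:1 :* :1)) refl i ⟩
    i * (1ℚ * 1ℚ)                                 ≡⟨ cong (i *_) (cong₂ _*_ (inv-suc m) (inv-suc n)) ⟨
    i * (inv (suc m) * ℕ→ℚ (suc m) * (inv (suc n) * ℕ→ℚ (suc n)))
      ≡⟨ solve 5 (λ i a b c d → i :* (a :* b :* (c :* d)) := i :* (b :* d) :* (a :* c)) refl i (inv (suc m)) (ℕ→ℚ (suc m)) (inv (suc n)) (ℕ→ℚ (suc n)) ⟩
    i * (ℕ→ℚ (suc m) * ℕ→ℚ (suc n)) * (inv (suc m) * inv (suc n))
      ≡⟨ cong (λ x → i * x * (inv (suc m) * inv (suc n))) (ℕ→ℚ-* (suc m) (suc n)) ⟨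
    i * ℕ→ℚ (suc m ℕ.* suc n) * (inv (suc m) * inv (suc n))
      ≡⟨ cong (_* (inv (suc m) * inv (suc n))) (inv-suc (n ℕ.+ m ℕ.* suc n)) ⟩
    1ℚ * (inv (suc m) * inv (suc n))              ≡⟨ ℚ.*-identityˡ _ ⟩
    inv (suc m) * inv (suc n)                     ∎
    where
    open ≡-Reasoning
    i = inv (suc m ℕ.* suc n)

  infix 4 _≈_
  _≈_ : Series → Series → Set
  f ≈ g = ∀ n → f n ≡ g n

  ⊛-applyUpTo : ∀ f g n → (f ⊛ g) n ≡ sumℚ (applyUpTo (λ i → f i * g (n ∸ i)) (suc n))
  ⊛-applyUpTo f g n = cong sumℚ (List.map-applyUpTo id (λ i → f i * g (n ∸ i)) (suc n))

  ⊛-zero : ∀ f g → (f ⊛ g) 0 ≡ f 0 * g 0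
  ⊛-zero f g = ℚ.+-identityʳ _

  ⊛-sucˡ : ∀ f g n → (f ⊛ g) (suc n) ≡ f 0 * g (suc n) + ((f ∘ suc) ⊛ g) n
  ⊛-sucˡ f g n = trans (⊛-applyUpTo f g (suc n)) (cong ((f 0 * g (suc n)) +_) (sym (⊛-applyUpTo (f ∘ suc) g n)))

  ⊛-sucʳ : ∀ f g n → (f ⊛ g) (suc n) ≡ (f ⊛ (g ∘ suc)) n + f (suc n) * g 0
  ⊛-sucʳ f g zero = trans (⊛-sucˡ f g 0) (cong₂ _+_ (sym (⊛-zero f (g ∘ suc))) (⊛-zero (f ∘ suc) g))
  ⊛-sucʳ f g (suc n) = begin
    (f ⊛ g) (suc (suc n))                                                          ≡⟨ ⊛-sucˡ f g (suc n) ⟩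
    f 0 * g (suc (suc n)) + ((f ∘ suc) ⊛ g) (suc n)                                ≡⟨ cong ((f 0 * g (suc (suc n))) +_) (⊛-sucʳ (f ∘ suc) g n) ⟩
    f 0 * g (suc (suc n)) + (((f ∘ suc) ⊛ (g ∘ suc)) n + f (suc (suc n)) * g 0)    ≡⟨ ℚ.+-assoc (f 0 * g (suc (suc n))) _ _ ⟨
    f 0 * g (suc (suc n)) + ((f ∘ suc) ⊛ (g ∘ suc)) n + f (suc (suc n)) * g 0      ≡⟨ cong (_+ (f (suc (suc n)) * g 0)) (⊛-sucˡ f (g ∘ suc) n) ⟨
    (f ⊛ (g ∘ suc)) (suc n) + f (suc (suc n)) * g 0                                ∎
    where open ≡-Reasoning

  ⊛-cong : ∀ {f f′ g g′} → f ≈ f′ → g ≈ g′ → f ⊛ g ≈ f′ ⊛ g′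
  ⊛-cong {f} {f′} {g} {g′} ef eg zero = trans (⊛-zero f g) (trans (cong₂ _*_ (ef 0) (eg 0)) (sym (⊛-zero f′ g′)))
  ⊛-cong {f} {f′} {g} {g′} ef eg (suc n) = trans (⊛-sucˡ f g n)
    (trans (cong₂ _+_ (cong₂ _*_ (ef 0) (eg (suc n))) (⊛-cong (ef ∘ suc) eg n)) (sym (⊛-sucˡ f′ g′ n)))

  ⊛-comm : ∀ f g → f ⊛ g ≈ g ⊛ f
  ⊛-comm f g zero = trans (⊛-zero f g) (trans (ℚ.*-comm (f 0) (g 0)) (sym (⊛-zero g f)))
  ⊛-comm f g (suc n) = begin
    (f ⊛ g) (suc n)                          ≡⟨ ⊛-sucˡ f g n ⟩
    f 0 * g (suc n) + ((f ∘ suc) ⊛ g) n      ≡⟨ cong₂ _+_ (ℚ.*-comm (f 0) (g (suc n))) (⊛-comm (f ∘ suc) g n) ⟩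
    g (suc n) * f 0 + (g ⊛ (f ∘ suc)) n      ≡⟨ ℚ.+-comm (g (suc n) * f 0) _ ⟩
    (g ⊛ (f ∘ suc)) n + g (suc n) * f 0      ≡⟨ ⊛-sucʳ g f n ⟨
    (g ⊛ f) (suc n)                          ∎
    where open ≡-Reasoning

  ⊛-distribʳ : ∀ h f g → (λ n → f n + g n) ⊛ h ≈ (λ n → (f ⊛ h) n + (g ⊛ h) n)
  ⊛-distribʳ h f g zero = trans (⊛-zero (λ n → f n + g n) h) (trans (ℚ.*-distribʳ-+ (h 0) (f 0) (g 0)) (sym (cong₂ _+_ (⊛-zero f h) (⊛-zero g h))))
  ⊛-distribʳ h f g (suc n) = begin
    ((λ n → f n + g n) ⊛ h) (suc n)
      ≡⟨ ⊛-sucˡ (λ n → f n + g n) h n ⟩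
    (f 0 + g 0) * h (suc n) + ((λ n → f (suc n) + g (suc n)) ⊛ h) n
      ≡⟨ cong (((f 0 + g 0) * h (suc n)) +_) (⊛-distribʳ h (f ∘ suc) (g ∘ suc) n) ⟩
    (f 0 + g 0) * h (suc n) + (((f ∘ suc) ⊛ h) n + ((g ∘ suc) ⊛ h) n)
      ≡⟨ solve 5 (λ a b c x y → (a :+ b) :* c :+ (x :+ y) := (a :* c :+ x) :+ (b :* c :+ y)) refl
           (f 0) (g 0) (h (suc n)) (((f ∘ suc) ⊛ h) n) (((g ∘ suc) ⊛ h) n) ⟩
    (f 0 * h (suc n) + ((f ∘ suc) ⊛ h) n) + (g 0 * h (suc n) + ((g ∘ suc) ⊛ h) n)
      ≡⟨ cong₂ _+_ (⊛-sucˡ f h n) (⊛-sucˡ g h n) ⟨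
    (f ⊛ h) (suc n) + (g ⊛ h) (suc n) ∎
    where open ≡-Reasoning

  infixr 8 _·_
  _·_ : ℚ → Series → Series
  (k · f) n = k * f n

  ·-⊛ : ∀ k f g → (k · f) ⊛ g ≈ k · (f ⊛ g)
  ·-⊛ k f g zero = trans (⊛-zero (k · f) g) (trans (ℚ.*-assoc k (f 0) (g 0)) (cong (k *_) (sym (⊛-zero f g))))
  ·-⊛ k f g (suc n) = begin
    ((k · f) ⊛ g) (suc n)                                ≡⟨ ⊛-sucˡ (k · f) g n ⟩
    k * f 0 * g (suc n) + ((k · (f ∘ suc)) ⊛ g) n        ≡⟨ cong₂ _+_ (ℚ.*-assoc k (f 0) (g (suc n))) (·-⊛ k (f ∘ suc) g n) ⟩
    k * (f 0 * g (suc n)) + k * ((f ∘ suc) ⊛ g) n        ≡⟨ ℚ.*-distribˡ-+ k _ _ ⟨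
    k * (f 0 * g (suc n) + ((f ∘ suc) ⊛ g) n)            ≡⟨ cong (k *_) (⊛-sucˡ f g n) ⟨
    k * (f ⊛ g) (suc n)                                  ∎
    where open ≡-Reasoning

  ⊛-assoc : ∀ f g h → (f ⊛ g) ⊛ h ≈ f ⊛ (g ⊛ h)
  ⊛-assoc f g h zero = trans (⊛-zero (f ⊛ g) h) (trans (cong (_* h 0) (⊛-zero f g)) (trans (ℚ.*-assoc (f 0) (g 0) (h 0))
    (trans (cong (f 0 *_) (sym (⊛-zero g h))) (sym (⊛-zero f (g ⊛ h))))))
  ⊛-assoc f g h (suc n) = begin
    ((f ⊛ g) ⊛ h) (suc n)
      ≡⟨ ⊛-sucˡ (f ⊛ g) h n ⟩
    (f ⊛ g) 0 * h (suc n) + (((f ⊛ g) ∘ suc) ⊛ h) n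
      ≡⟨ cong₂ (λ x y → x * h (suc n) + y) (⊛-zero f g)
           (trans (⊛-cong {g = h} (⊛-sucˡ f g) (λ _ → refl) n) (⊛-distribʳ h (f 0 · (g ∘ suc)) ((f ∘ suc) ⊛ g) n)) ⟩
    f 0 * g 0 * h (suc n) + (((f 0 · (g ∘ suc)) ⊛ h) n + (((f ∘ suc) ⊛ g) ⊛ h) n)
      ≡⟨ cong ((f 0 * g 0 * h (suc n)) +_) (cong₂ _+_ (·-⊛ (f 0) (g ∘ suc) h n) (⊛-assoc (f ∘ suc) g h n)) ⟩
    f 0 * g 0 * h (suc n) + (f 0 * ((g ∘ suc) ⊛ h) n + ((f ∘ suc) ⊛ (g ⊛ h)) n)
      ≡⟨ solve 5 (λ a b c x y → a :* b :* c :+ (a :* x :+ y) := a :* (b :* c :+ x) :+ y) refl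
           (f 0) (g 0) (h (suc n)) (((g ∘ suc) ⊛ h) n) (((f ∘ suc) ⊛ (g ⊛ h)) n) ⟩
    f 0 * (g 0 * h (suc n) + ((g ∘ suc) ⊛ h) n) + ((f ∘ suc) ⊛ (g ⊛ h)) n
      ≡⟨ cong (λ x → f 0 * x + ((f ∘ suc) ⊛ (g ⊛ h)) n) (⊛-sucˡ g h n) ⟨
    f 0 * (g ⊛ h) (suc n) + ((f ∘ suc) ⊛ (g ⊛ h)) n
      ≡⟨ ⊛-sucˡ f (g ⊛ h) n ⟨
    (f ⊛ (g ⊛ h)) (suc n) ∎
    where open ≡-Reasoning

  ⊛-zeroˡ : ∀ f → (λ _ → 0ℚ) ⊛ f ≈ λ _ → 0ℚ
  ⊛-zeroˡ f zero = trans (⊛-zero (λ _ → 0ℚ) f) (ℚ.*-zeroˡ (f 0))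
  ⊛-zeroˡ f (suc n) = trans (⊛-sucˡ (λ _ → 0ℚ) f n) (trans (cong₂ _+_ (ℚ.*-zeroˡ (f (suc n))) (⊛-zeroˡ f n)) (ℚ.+-identityˡ 0ℚ))

  ⊛-identityˡ : ∀ f → oneS ⊛ f ≈ f
  ⊛-identityˡ f zero = trans (⊛-zero oneS f) (ℚ.*-identityˡ (f 0))
  ⊛-identityˡ f (suc n) = trans (⊛-sucˡ oneS f n) (trans (cong₂ _+_ (ℚ.*-identityˡ (f (suc n))) (⊛-zeroˡ f n)) (ℚ.+-identityʳ (f (suc n))))

  seriesRing : CommutativeRing 0ℓ 0ℓ
  seriesRing = record
    { Carrier = Series
    ; _≈_ = _≈_
    ; _+_ = λ f g n → f n + g n
    ; _*_ = _⊛_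
    ; -_ = λ f n → - f n
    ; 0# = λ _ → 0ℚ
    ; 1# = oneS
    ; isCommutativeRing = record
      { isRing = record
        { +-isAbelianGroup = Pointwise.isAbelianGroup ℕ ℚ.+-0-isAbelianGroup
        ; *-cong = ⊛-cong
        ; *-assoc = ⊛-assoc
        ; *-identity = ⊛-identityˡ , λ f n → trans (⊛-comm f oneS n) (⊛-identityˡ f n)
        ; distrib = (λ f g h n → trans (⊛-comm f (λ n → g n + h n) n)
                      (trans (⊛-distribʳ f g h n) (cong₂ _+_ (⊛-comm g f n) (⊛-comm h f n))))
                  , ⊛-distribʳ
        }
      ; *-comm = ⊛-comm
      }
    }

  module 𝕊 = CommutativeRing seriesRing

  zS : Series
  zS zero = 0ℚ
  zS (suc n) = oneS n

  zS-⊛-zero : ∀ f → (zS ⊛ f) 0 ≡ 0ℚ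
  zS-⊛-zero f = trans (⊛-zero zS f) (ℚ.*-zeroˡ (f 0))

  zS-⊛-suc : ∀ f n → (zS ⊛ f) (suc n) ≡ f n
  zS-⊛-suc f n = trans (⊛-sucˡ zS f n) (trans (cong₂ _+_ (ℚ.*-zeroˡ (f (suc n))) (⊛-identityˡ f n)) (ℚ.+-identityˡ (f n)))

  zS-cancellable : Cancellable seriesRing zS
  zS-cancellable {y} e n = trans (sym (zS-⊛-suc y n)) (e (suc n))

  ⊛-vanish : ∀ f {g} n → (∀ {k} → k ≤ n → g k ≡ 0ℚ) → (f ⊛ g) n ≡ 0ℚ
  ⊛-vanish f {g} zero e = trans (⊛-zero f g) (trans (cong (f 0 *_) (e z≤n)) (ℚ.*-zeroʳ (f 0)))
  ⊛-vanish f {g} (suc n) e = trans (⊛-sucˡ f g n)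
    (trans (cong₂ _+_ (trans (cong (f 0 *_) (e ℕ.≤-refl)) (ℚ.*-zeroʳ (f 0))) (⊛-vanish (f ∘ suc) n (λ k≤n → e (ℕ.m≤n⇒m≤1+n k≤n))))
           (ℚ.+-identityˡ 0ℚ))

  leading-cancellable : ∀ f i → i * f 0 ≡ 1ℚ → Cancellable seriesRing f
  leading-cancellable f i if₀ {y} e n = below n ℕ.≤-refl
    where
    cancel-leading : ∀ {x} → f 0 * x ≡ 0ℚ → x ≡ 0ℚ
    cancel-leading {x} fx = begin
      x              ≡⟨ ℚ.*-identityˡ x ⟨
      1ℚ * x         ≡⟨ cong (_* x) if₀ ⟨
      i * f 0 * x    ≡⟨ ℚ.*-assoc i (f 0) x ⟩
      i * (f 0 * x)  ≡⟨ cong (i *_) fx ⟩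
      i * 0ℚ         ≡⟨ ℚ.*-zeroʳ i ⟩
      0ℚ             ∎
      where open ≡-Reasoning
    below : ∀ n {k} → k ≤ n → y k ≡ 0ℚ
    below n {zero} _ = cancel-leading (trans (sym (⊛-zero f y)) (e 0))
    below (suc n) {suc k} (s≤s k≤n) = cancel-leading (begin
      f 0 * y (suc k)                          ≡⟨ ℚ.+-identityʳ _ ⟨
      f 0 * y (suc k) + 0ℚ                     ≡⟨ cong ((f 0 * y (suc k)) +_) (⊛-vanish (f ∘ suc) k (λ j≤k → below n (ℕ.≤-trans j≤k k≤n))) ⟨
      f 0 * y (suc k) + ((f ∘ suc) ⊛ y) k      ≡⟨ ⊛-sucˡ f y k ⟨
      (f ⊛ y) (suc k)                          ≡⟨ e (suc k) ⟩
      0ℚ                                       ∎)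
      where open ≡-Reasoning

  -- The quotient g / f for a series f with constant term 1.
  divide : Series → Series → Series
  divide g f zero = g 0
  divide g f (suc n) = divide (λ k → g (suc k) - g 0 * f (suc k)) f n

  ⊛-divide : ∀ f → f 0 ≡ 1ℚ → ∀ g → f ⊛ divide g f ≈ g
  ⊛-divide f f₀ g zero = trans (⊛-zero f (divide g f)) (trans (cong (_* g 0) f₀) (ℚ.*-identityˡ (g 0)))
  ⊛-divide f f₀ g (suc n) = begin
    (f ⊛ divide g f) (suc n)                                                              ≡⟨ ⊛-sucʳ f (divide g f) n ⟩
    (f ⊛ divide (λ k → g (suc k) - g 0 * f (suc k)) f) n + f (suc n) * g 0                ≡⟨ cong (_+ (f (suc n) * g 0)) (⊛-divide f f₀ _ n) ⟩
    g (suc n) - g 0 * f (suc n) + f (suc n) * g 0                                         ≡⟨ solve 3 (λ x y z → x :- y :* z :+ z :* y := x) refl (g (suc n)) (g 0) (f (suc n)) ⟩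
    g (suc n)                                                                             ∎
    where open ≡-Reasoning

  evens odds : ℕ → Series
  evens h k = ℕ→ℚ (h C (2 ℕ.* k))
  odds h k = ℕ→ℚ (h C suc (2 ℕ.* k))

  nC0≡1 : ∀ n → n C 0 ≡ 1
  nC0≡1 n = trans (nCk≡nC[n∸k] {0} {n} z≤n) (nCn≡1 n)

  evens-zero : evens 0 ≈ oneS
  evens-zero zero = refl
  evens-zero (suc k) = cong ℕ→ℚ (k>n⇒nCk≡0 {0} {2 ℕ.* suc k} (s≤s z≤n))

  odds-zero : odds 0 ≈ 𝕊.0#
  odds-zero k = cong ℕ→ℚ (k>n⇒nCk≡0 {0} {suc (2 ℕ.* k)} (s≤s z≤n))

  evens-0 : ∀ h → evens h 0 ≡ 1ℚ
  evens-0 h = cong ℕ→ℚ (nC0≡1 h)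

  odds-0 : ∀ h → odds h 0 ≡ ℕ→ℚ h
  odds-0 h = cong ℕ→ℚ (nC1≡n h)

  -- Pascal's rule: the even part of (1 + √z)^h multiplied by 1 + √z.
  evens-suc : ∀ h → evens (suc h) ≈ evens h 𝕊.+ zS ⊛ odds h
  evens-suc h zero = trans (evens-0 (suc h)) (sym (trans (cong₂ _+_ (evens-0 h) (zS-⊛-zero (odds h))) (ℚ.+-identityʳ 1ℚ)))
  evens-suc h (suc k) = begin
    ℕ→ℚ (suc h C (2 ℕ.* suc k))                                 ≡⟨ cong (λ i → ℕ→ℚ (suc h C i)) double ⟩
    ℕ→ℚ (suc h C suc (suc (2 ℕ.* k)))                           ≡⟨ cong ℕ→ℚ (nCk+nC[k+1]≡[n+1]C[k+1] h (suc (2 ℕ.* k))) ⟨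
    ℕ→ℚ (h C suc (2 ℕ.* k) ℕ.+ h C suc (suc (2 ℕ.* k)))         ≡⟨ ℕ→ℚ-+ (h C suc (2 ℕ.* k)) (h C suc (suc (2 ℕ.* k))) ⟩
    odds h k + ℕ→ℚ (h C suc (suc (2 ℕ.* k)))                    ≡⟨ ℚ.+-comm (odds h k) _ ⟩
    ℕ→ℚ (h C suc (suc (2 ℕ.* k))) + odds h k                    ≡⟨ cong₂ _+_ (cong (λ i → ℕ→ℚ (h C i)) double) (zS-⊛-suc (odds h) k) ⟨
    evens h (suc k) + (zS ⊛ odds h) (suc k)                     ∎
    where
    open ≡-Reasoning
    double : 2 ℕ.* suc k ≡ suc (suc (2 ℕ.* k))
    double = ℕ.*-suc 2 k

  odds-suc : ∀ h → odds (suc h) ≈ evens h 𝕊.+ odds h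
  odds-suc h k = trans (cong ℕ→ℚ (sym (nCk+nC[k+1]≡[n+1]C[k+1] h (2 ℕ.* k)))) (ℕ→ℚ-+ (h C (2 ℕ.* k)) (h C suc (2 ℕ.* k)))

  -- Since `rhoRev` lists its coefficients from the highest down, the zipped sum is a convolution.
  -- The index map `e` is arbitrary so that it can shift during the induction.
  zipWith-rhoRev : ∀ h (β : ℕ → ℚ) e k →
    sumℚ (zipWith (λ j c → β j * c) (applyUpTo e (suc k)) (rhoRev h k)) ≡ ((β ∘ e) ⊛ ρ h) k
  zipWith-rhoRev h β e zero = refl
  zipWith-rhoRev h β e (suc k) = trans (cong ((β (e 0) * ρ h (suc k)) +_) (zipWith-rhoRev h β (e ∘ suc) k)) (sym (⊛-sucˡ (β ∘ e) (ρ h) k))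

  ρ-0 : ∀ h → ρ h 0 ≡ 1ℚ
  ρ-0 h = trans (cong₂ _-_ (evens-0 h) (ℚ.*-zeroʳ (inv h))) (ℚ.+-identityʳ 1ℚ)

  odds-⊛-ρ : ∀ n → odds (suc n) ⊛ ρ (suc n) ≈ ℕ→ℚ (suc n) · evens (suc n)
  odds-⊛-ρ n zero = begin
    (odds h ⊛ ρ h) 0         ≡⟨ ⊛-zero (odds h) (ρ h) ⟩
    odds h 0 * ρ h 0         ≡⟨ cong₂ _*_ (odds-0 h) (trans (ρ-0 h) (sym (evens-0 h))) ⟩
    ℕ→ℚ h * evens h 0        ∎
    where
    open ≡-Reasoning
    h = suc n
  odds-⊛-ρ n (suc k) = begin
    (odds h ⊛ ρ h) (suc k)
      ≡⟨ ⊛-sucˡ (odds h) (ρ h) k ⟩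
    odds h 0 * (evens h (suc k) - inv h * sumℚ (zipWith (λ j c → odds h j * c) (applyUpTo suc (suc k)) (rhoRev h k))) + tail
      ≡⟨ cong₂ (λ x y → x * (evens h (suc k) - inv h * y) + tail) (odds-0 h) (zipWith-rhoRev h (odds h) suc k) ⟩
    ℕ→ℚ h * (evens h (suc k) - inv h * tail) + tail
      ≡⟨ solve 4 (λ h a i t → h :* (a :- i :* t) :+ t := h :* a :+ (:1 :- i :* h) :* t) refl (ℕ→ℚ h) (evens h (suc k)) (inv h) tail ⟩
    ℕ→ℚ h * evens h (suc k) + (1ℚ - inv h * ℕ→ℚ h) * tail
      ≡⟨ cong (λ x → ℕ→ℚ h * evens h (suc k) + (1ℚ - x) * tail) (inv-suc n) ⟩
    ℕ→ℚ h * evens h (suc k) + (1ℚ - 1ℚ) * tail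
      ≡⟨ solve 2 (λ x t → x :+ (:1 :- :1) :* t := x) refl (ℕ→ℚ h * evens h (suc k)) tail ⟩
    ℕ→ℚ h * evens h (suc k) ∎
    where
    open ≡-Reasoning
    h = suc n
    tail = ((odds h ∘ suc) ⊛ ρ h) k

  -- The tangent is a genuine quotient because `evens h` always has constant term 1; `odds h` has
  -- constant term h, so the cotangent is taken from `ρ` instead.
  cotangent tangent : ℕ → Series
  cotangent h = inv h · ρ h
  tangent h = divide (odds h) (evens h)

  evens-cancellable : ∀ h → Cancellable seriesRing (evens h)
  evens-cancellable h = leading-cancellable (evens h) 1ℚ (trans (ℚ.*-identityˡ _) (evens-0 h))

  odds-cancellable : ∀ n → Cancellable seriesRing (odds (suc n))
  odds-cancellable n = leading-cancellable (odds (suc n)) (inv (suc n)) (trans (cong (inv (suc n) *_) (odds-0 (suc n))) (inv-suc n))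

  tangent-evens : ∀ h → tangent h ⊛ evens h ≈ odds h
  tangent-evens h n = trans (⊛-comm (tangent h) (evens h) n) (⊛-divide (evens h) (evens-0 h) (odds h) n)

  cotangent-odds : ∀ n → cotangent (suc n) ⊛ odds (suc n) ≈ evens (suc n)
  cotangent-odds n k = begin
    (cotangent h ⊛ odds h) k            ≡⟨ ·-⊛ (inv h) (ρ h) (odds h) k ⟩
    inv h * (ρ h ⊛ odds h) k            ≡⟨ cong (inv h *_) (trans (⊛-comm (ρ h) (odds h) k) (odds-⊛-ρ n k)) ⟩
    inv h * (ℕ→ℚ h * evens h k)         ≡⟨ ℚ.*-assoc (inv h) (ℕ→ℚ h) (evens h k) ⟨
    inv h * ℕ→ℚ h * evens h k           ≡⟨ cong (_* evens h k) (inv-suc n) ⟩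
    1ℚ * evens h k                      ≡⟨ ℚ.*-identityˡ (evens h k) ⟩
    evens h k                           ∎
    where
    open ≡-Reasoning
    h = suc n

  cancelʳ : ∀ {x y f} → Cancellable seriesRing f → x ⊛ f ≈ y ⊛ f → x ≈ y
  cancelʳ {x} {y} {f} c e = x∙y⁻¹≈ε⇒x≈y x y (c {λ n → x n - y n} (𝕊.trans (𝕊.*-comm f (x 𝕊.- y)) (𝕊.trans ([y-z]x≈yx-zx f x y) (x≈y⇒x∙y⁻¹≈ε e))))
    where
    open import Algebra.Properties.Group 𝕊.+-group using (x∙y⁻¹≈ε⇒x≈y; x≈y⇒x∙y⁻¹≈ε)
    open import Algebra.Properties.Ring 𝕊.ring using ([y-z]x≈yx-zx)

  tangent-0 : tangent 0 ≈ 𝕊.0#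
  tangent-0 = cancelʳ {f = evens 0} (evens-cancellable 0) (𝕊.trans (tangent-evens 0) (𝕊.trans odds-zero (𝕊.sym (⊛-zeroˡ (evens 0)))))

  tangent-1 : tangent 1 ≈ oneS
  tangent-1 = cancelʳ {f = evens 1} (evens-cancellable 1) (begin
    tangent 1 ⊛ evens 1           ≈⟨ tangent-evens 1 ⟩
    odds 1                        ≈⟨ odds-suc 0 ⟩
    evens 0 𝕊.+ odds 0            ≈⟨ 𝕊.+-congˡ {evens 0} (𝕊.trans odds-zero (𝕊.sym (𝕊.trans (𝕊.*-congˡ {zS} odds-zero) (𝕊.zeroʳ zS)))) ⟩
    evens 0 𝕊.+ zS ⊛ odds 0       ≈⟨ evens-suc 0 ⟨
    evens 1                       ≈⟨ ⊛-identityˡ (evens 1) ⟨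
    oneS ⊛ evens 1                ∎)
    where open import Relation.Binary.Reasoning.Setoid 𝕊.setoid

  cotangent-tangent : ∀ n → cotangent (suc n) ⊛ tangent (suc n) ≈ oneS
  cotangent-tangent n = cancelʳ {f = evens h} (evens-cancellable h) (begin
    (cotangent h ⊛ tangent h) ⊛ evens h    ≈⟨ ⊛-assoc (cotangent h) (tangent h) (evens h) ⟩
    cotangent h ⊛ (tangent h ⊛ evens h)    ≈⟨ 𝕊.*-congˡ {cotangent h} (tangent-evens h) ⟩
    cotangent h ⊛ odds h                   ≈⟨ cotangent-odds n ⟩
    evens h                                ≈⟨ ⊛-identityˡ (evens h) ⟨
    oneS ⊛ evens h                         ∎)
    where
    open import Relation.Binary.Reasoning.Setoid 𝕊.setoid
    h = suc n

  seriesTangents : Tangents seriesRing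
  seriesTangents = record
    { t = tangent ; w = cotangent ; t-0 = tangent-0 ; t-1 = tangent-1 ; w*t = cotangent-tangent }

  seriesAdditionLaw : AdditionLaw seriesTangents
  seriesAdditionLaw = record
    { z = zS ; a = evens ; b = odds
    ; a-0 = evens-zero ; b-0 = odds-zero ; a-suc = evens-suc ; b-suc = odds-suc
    ; t*a = tangent-evens ; w*b = cotangent-odds
    ; z-cancel = λ {y} → zS-cancellable {y}
    ; 1-z-cancel = leading-cancellable (oneS 𝕊.- zS) 1ℚ refl
    ; a-cancel = evens-cancellable
    ; b-cancel = odds-cancellable
    }

  rationalTangents : Tangents ℚ.+-*-commutativeRing
  rationalTangents = record
    { t = ℕ→ℚ ; w = inv ; t-0 = refl ; t-1 = refl ; w*t = inv-suc }

-- The difference operator and its powers on L_r/H.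

module Differences where
  open import Data.Rational using (_+_; _*_; _-_; -_)
  open ≡ using (refl; sym; trans; cong; cong₂)
  open PowerSeries

  open Neighbours ℚ.+-*-commutativeRing
  open YoungLattice ℚ.+-*-commutativeRing
  module NS = Neighbours seriesRing
  module YS = YoungLattice seriesRing
  module PS = Products seriesRing
  module PQ = Products ℚ.+-*-commutativeRing

  sum-upsFrom : ∀ p (g : List ℕ → ℚ) xs → sumℚ (map g (upsFrom p xs)) ≡ up p g xs
  sum-upsFrom p g [] = ℚ.+-identityʳ _
  sum-upsFrom p g (x ∷ xs) with canInc p x
  ... | true = cong (g (suc x ∷ xs) +_) (trans (cong sumℚ (sym (List.map-∘ (upsFrom (just x) xs)))) (sum-upsFrom (just x) (g ∘ (x ∷_)) xs))
  ... | false = trans (trans (cong sumℚ (sym (List.map-∘ (upsFrom (just x) xs)))) (sum-upsFrom (just x) (g ∘ (x ∷_)) xs)) (sym (ℚ.+-identityˡ _))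

  D-up : ∀ g xs → D g xs ≡ up nothing g xs - g xs
  D-up g xs = cong (_- g xs) (sum-upsFrom nothing g xs)

  D-cong : ∀ {g h xs} → Partition nothing xs → (∀ {ν} → Partition nothing ν → g ν ≡ h ν) → D g xs ≡ D h xs
  D-cong {g} {h} {xs} π e = trans (D-up g xs) (trans (cong₂ _-_ (up-cong tt π e) (e π)) (sym (D-up h xs)))

  D-+ : ∀ g h xs → D (λ ν → g ν + h ν) xs ≡ D g xs + D h xs
  D-+ g h xs = begin
    D (λ ν → g ν + h ν) xs                                    ≡⟨ D-up _ xs ⟩
    up nothing (λ ν → g ν + h ν) xs - (g xs + h xs)           ≡⟨ cong (_- (g xs + h xs)) (up-+ nothing g h xs) ⟩
    up nothing g xs + up nothing h xs - (g xs + h xs)         ≡⟨ ℚSolver.solve 4 (λ a b c d → (a :+ b) :- (c :+ d) := (a :- c) :+ (b :- d)) refl (up nothing g xs) (up nothing h xs) (g xs) (h xs) ⟩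
    (up nothing g xs - g xs) + (up nothing h xs - h xs)       ≡⟨ cong₂ _+_ (D-up g xs) (D-up h xs) ⟨
    D g xs + D h xs                                           ∎
    where
    open ≡-Reasoning
    open ℚSolver

  D-* : ∀ k g xs → D (λ ν → k * g ν) xs ≡ k * D g xs
  D-* k g xs = begin
    D (λ ν → k * g ν) xs                      ≡⟨ D-up _ xs ⟩
    up nothing (λ ν → k * g ν) xs - k * g xs  ≡⟨ cong (_- (k * g xs)) (up-* nothing k g xs) ⟩
    k * up nothing g xs - k * g xs            ≡⟨ ℚSolver.solve 3 (λ k a c → k :* a :- k :* c := k :* (a :- c)) refl k (up nothing g xs) (g xs) ⟩
    k * (up nothing g xs - g xs)              ≡⟨ cong (k *_) (D-up g xs) ⟨
    k * D g xs                                ∎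
    where
    open ≡-Reasoning
    open ℚSolver

  growable-nothing : ∀ {xs} → Partition nothing xs → growable nothing xs ≡ true
  growable-nothing [] = refl
  growable-nothing (_ ∷ _) = refl

  D-down : ∀ g {xs} → Partition nothing xs → D (down g) xs ≡ down (D g) xs + g xs
  D-down g {xs} π = begin
    D (down g) xs                                        ≡⟨ D-up (down g) xs ⟩
    up nothing (down g) xs - down g xs                   ≡⟨ cong (_- down g xs) (up-down g tt π) ⟩
    down (up nothing g) xs + (if growable nothing xs then g xs else 0ℚ) - down g xs
      ≡⟨ cong (λ b → down (up nothing g) xs + (if b then g xs else 0ℚ) - down g xs) (growable-nothing π) ⟩
    down (up nothing g) xs + g xs - down g xs
      ≡⟨ ℚSolver.solve 3 (λ a b c → a :+ b :- c := a :+ (:- :1) :* c :+ b) refl (down (up nothing g) xs) (g xs) (down g xs) ⟩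
    down (up nothing g) xs + - 1ℚ * down g xs + g xs
      ≡⟨ cong (λ x → down (up nothing g) xs + x + g xs) (down-* (- 1ℚ) g xs) ⟨
    down (up nothing g) xs + down (λ ν → - 1ℚ * g ν) xs + g xs
      ≡⟨ cong (_+ g xs) (down-+ (up nothing g) _ xs) ⟨
    down (λ ν → up nothing g ν + - 1ℚ * g ν) xs + g xs
      ≡⟨ cong (_+ g xs) (down-cong π (λ {ν} _ → trans (ℚSolver.solve 2 (λ a b → a :+ (:- :1) :* b := a :- b) refl (up nothing g ν) (g ν)) (sym (D-up g ν)))) ⟩
    down (D g) xs + g xs ∎
    where
    open ≡-Reasoning
    open ℚSolver

  Dpow-cong : ∀ n {g h xs} → Partition nothing xs → (∀ {ν} → Partition nothing ν → g ν ≡ h ν) → Dpow n g xs ≡ Dpow n h xs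
  Dpow-cong zero π e = e π
  Dpow-cong (suc n) π e = D-cong π (λ ν → Dpow-cong n ν e)

  Dpow-D : ∀ n g → Dpow n (D g) ≡ Dpow (suc n) g
  Dpow-D zero g = refl
  Dpow-D (suc n) g = cong D (Dpow-D n g)

  Dpow-down : ∀ n g {xs} → Partition nothing xs →
              Dpow (suc n) (down g) xs ≡ down (Dpow (suc n) g) xs + ℕ→ℚ (suc n) * Dpow n g xs
  Dpow-down zero g {xs} π = trans (D-down g π) (cong (down (D g) xs +_) (sym (ℚ.*-identityˡ (g xs))))
  Dpow-down (suc n) g {xs} π = begin
    D (Dpow (suc n) (down g)) xs
      ≡⟨ D-cong π (Dpow-down n g) ⟩
    D (λ ν → down (Dpow (suc n) g) ν + ℕ→ℚ (suc n) * Dpow n g ν) xs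
      ≡⟨ trans (D-+ (down (Dpow (suc n) g)) _ xs) (cong₂ _+_ (D-down (Dpow (suc n) g) π) (D-* (ℕ→ℚ (suc n)) (Dpow n g) xs)) ⟩
    down (Dpow (suc (suc n)) g) xs + Dpow (suc n) g xs + ℕ→ℚ (suc n) * Dpow (suc n) g xs
      ≡⟨ ℚSolver.solve 3 (λ a b k → a :+ b :+ k :* b := a :+ (:1 :+ k) :* b) refl (down (Dpow (suc (suc n)) g) xs) (Dpow (suc n) g xs) (ℕ→ℚ (suc n)) ⟩
    down (Dpow (suc (suc n)) g) xs + (1ℚ + ℕ→ℚ (suc n)) * Dpow (suc n) g xs
      ≡⟨ cong (λ k → down (Dpow (suc (suc n)) g) xs + k * Dpow (suc n) g xs) (ℕ→ℚ-+ 1 (suc n)) ⟨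
    down (Dpow (suc (suc n)) g) xs + ℕ→ℚ (suc (suc n)) * Dpow (suc n) g xs ∎
    where
    open ≡-Reasoning
    open ℚSolver

  hookSeries : List ℕ → Series
  hookSeries xs = PS.∏ cotangent (hooks xs)

  -- The factor 1/H is spread over the boxes, turning each ρ(h) into ρ(h)/h.
  F-hookSeries : ∀ r xs → F r xs ≡ hookSeries xs r
  F-hookSeries r xs = trans (ℚ.*-comm (L r xs) (inv (H xs))) (weights (hooks xs) r)
    where
    weights : ∀ hs → inv (productℕ hs) · foldr (λ h s → ρ h ⊛ s) oneS hs ≈ PS.∏ cotangent hs
    weights [] n = ℚ.*-identityˡ (oneS n)
    weights (h ∷ hs) = begin
      inv (h ℕ.* p) · (ρ h ⊛ s)            ≈⟨ (λ n → trans (cong (_* (ρ h ⊛ s) n) (inv-* h p)) (ℚ.*-assoc (inv h) (inv p) ((ρ h ⊛ s) n))) ⟩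
      inv h · inv p · (ρ h ⊛ s)            ≈⟨ (λ n → cong (λ x → inv h * (inv p * x)) (⊛-comm (ρ h) s n)) ⟩
      inv h · inv p · (s ⊛ ρ h)            ≈⟨ (λ n → cong (inv h *_) (sym (·-⊛ (inv p) s (ρ h) n))) ⟩
      inv h · ((inv p · s) ⊛ ρ h)          ≈⟨ (λ n → cong (inv h *_) (⊛-comm (inv p · s) (ρ h) n)) ⟩
      inv h · (ρ h ⊛ (inv p · s))          ≈⟨ ·-⊛ (inv h) (ρ h) (inv p · s) ⟨
      cotangent h ⊛ (inv p · s)            ≈⟨ 𝕊.*-congˡ {cotangent h} (weights hs) ⟩
      cotangent h ⊛ PS.∏ cotangent hs      ∎
      where
      open import Relation.Binary.Reasoning.Setoid 𝕊.setoid
      p = productℕ hs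
      s = foldr (λ h s → ρ h ⊛ s) oneS hs

  up-coefficient : ∀ p (g : List ℕ → Series) r xs → NS.up p g xs r ≡ up p (λ ν → g ν r) xs
  up-coefficient p g r [] = refl
  up-coefficient p g r (x ∷ xs) with canInc p x
  ... | true = cong (g (suc x ∷ xs) r +_) (up-coefficient (just x) (g ∘ (x ∷_)) r xs)
  ... | false = cong (0ℚ +_) (up-coefficient (just x) (g ∘ (x ∷_)) r xs)

  down-coefficient : ∀ (g : List ℕ → Series) r xs → NS.down g xs r ≡ down (λ ν → g ν r) xs
  down-coefficient g r [] = refl
  down-coefficient g r (x ∷ xs) with canDec x xs
  ... | true = cong (g (pred x ∷₀ xs) r +_) (down-coefficient (g ∘ (x ∷_)) r xs)
  ... | false = cong (0ℚ +_) (down-coefficient (g ∘ (x ∷_)) r xs)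

  hookSeries-growth : ∀ {xs} → Partition nothing xs →
                      NS.up nothing hookSeries xs ≈ hookSeries xs 𝕊.+ zS ⊛ NS.down hookSeries xs
  hookSeries-growth {xs} π = begin
    NS.up nothing hookSeries xs               ≈⟨ YS.up-cong {g = hookSeries} {HP.G} tt π HP.∏-hooks ⟩
    NS.up nothing HP.G xs                     ≈⟨ HookGrowth.growth seriesAdditionLaw π ⟩
    HP.G xs 𝕊.+ zS ⊛ NS.down HP.G xs          ≈⟨ 𝕊.+-cong (HP.∏-hooks π) (𝕊.*-congˡ {zS} (YS.down-cong {g = hookSeries} {HP.G} π HP.∏-hooks)) ⟨
    hookSeries xs 𝕊.+ zS ⊛ NS.down hookSeries xs ∎
    where
    open import Relation.Binary.Reasoning.Setoid 𝕊.setoid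
    module HP = HookProducts seriesTangents

  up-F : ∀ r {xs} → Partition nothing xs → up nothing (F r) xs ≡ F r xs + (zS ⊛ NS.down hookSeries xs) r
  up-F r {xs} π = begin
    up nothing (F r) xs                                  ≡⟨ up-cong tt π (λ {ν} _ → F-hookSeries r ν) ⟩
    up nothing (λ ν → hookSeries ν r) xs                 ≡⟨ up-coefficient nothing hookSeries r xs ⟨
    NS.up nothing hookSeries xs r                        ≡⟨ hookSeries-growth π r ⟩
    hookSeries xs r + (zS ⊛ NS.down hookSeries xs) r     ≡⟨ cong (_+ (zS ⊛ NS.down hookSeries xs) r) (F-hookSeries r xs) ⟨
    F r xs + (zS ⊛ NS.down hookSeries xs) r              ∎
    where open ≡-Reasoning

  D-F : ∀ r {xs} → Partition nothing xs → D (F r) xs ≡ (zS ⊛ NS.down hookSeries xs) r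
  D-F r {xs} π = trans (D-up (F r) xs) (trans (cong (_- F r xs) (up-F r π))
    (ℚSolver.solve 2 (λ a b → a :+ b :- a := b) refl (F r xs) ((zS ⊛ NS.down hookSeries xs) r)))
    where open ℚSolver

  D-F-zero : ∀ {xs} → Partition nothing xs → D (F 0) xs ≡ 0ℚ
  D-F-zero {xs} π = trans (D-F 0 π) (zS-⊛-zero (NS.down hookSeries xs))

  D-F-suc : ∀ r {xs} → Partition nothing xs → D (F (suc r)) xs ≡ down (F r) xs
  D-F-suc r {xs} π = begin
    D (F (suc r)) xs                             ≡⟨ D-F (suc r) π ⟩
    (zS ⊛ NS.down hookSeries xs) (suc r)         ≡⟨ zS-⊛-suc (NS.down hookSeries xs) r ⟩
    NS.down hookSeries xs r                      ≡⟨ down-coefficient hookSeries r xs ⟩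
    down (λ ν → hookSeries ν r) xs               ≡⟨ down-cong π (λ {ν} _ → F-hookSeries r ν) ⟨
    down (F r) xs                                ∎
    where open ≡-Reasoning

  F-zero : ∀ xs → F 0 xs ≡ inv (H xs)
  F-zero xs = trans (cong (_* inv (H xs)) (leading (hooks xs))) (ℚ.*-identityˡ (inv (H xs)))
    where
    leading : ∀ hs → foldr (λ h s → ρ h ⊛ s) oneS hs 0 ≡ 1ℚ
    leading [] = refl
    leading (h ∷ hs) = trans (⊛-zero (ρ h) (foldr (λ h s → ρ h ⊛ s) oneS hs)) (trans (cong₂ _*_ (ρ-0 h) (leading hs)) (ℚ.*-identityˡ 1ℚ))

  inv-H : ∀ xs → inv (H xs) ≡ PQ.∏ inv (hooks xs)
  inv-H xs = factors (hooks xs)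
    where
    factors : ∀ hs → inv (productℕ hs) ≡ PQ.∏ inv hs
    factors [] = refl
    factors (h ∷ hs) = trans (inv-* h (productℕ hs)) (cong (inv h *_) (factors hs))

  -- The constant term of ρ(h)/h is 1/h, so `F 0` is the hook product of the linear tangents.
  down-F-zero : ∀ {xs} → Partition nothing xs → down (F 0) xs ≡ inv (H xs) * ℕ→ℚ (size xs)
  down-F-zero {xs} π = begin
    down (F 0) xs                  ≡⟨ down-cong π F-G ⟩
    down HQ.G xs                   ≡⟨ LinearTangents.down-size rationalTangents (ℕ→ℚ-+ 1) π ⟩
    HQ.G xs * ℕ→ℚ (size xs)        ≡⟨ cong (_* ℕ→ℚ (size xs)) (trans (sym (F-G π)) (F-zero xs)) ⟩
    inv (H xs) * ℕ→ℚ (size xs)     ∎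
    where
    open ≡-Reasoning
    module HQ = HookProducts rationalTangents
    F-G : ∀ {ν} → Partition nothing ν → F 0 ν ≡ HQ.G ν
    F-G {ν} π = trans (F-zero ν) (trans (inv-H ν) (HQ.∏-hooks π))

  D-down-F-zero : ∀ {xs} → Partition nothing xs → D (down (F 0)) xs ≡ F 0 xs
  D-down-F-zero {xs} π = begin
    D (down (F 0)) xs                        ≡⟨ D-down (F 0) π ⟩
    down (D (F 0)) xs + F 0 xs               ≡⟨ cong (_+ F 0 xs) (down-cong {h = λ ν → 0ℚ * F 0 ν} π (λ {ν} ν′ → trans (D-F-zero ν′) (sym (ℚ.*-zeroˡ (F 0 ν))))) ⟩
    down (λ ν → 0ℚ * F 0 ν) xs + F 0 xs      ≡⟨ cong (_+ F 0 xs) (trans (down-* 0ℚ (F 0) xs) (ℚ.*-zeroˡ (down (F 0) xs))) ⟩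
    0ℚ + F 0 xs                              ≡⟨ ℚ.+-identityˡ (F 0 xs) ⟩
    F 0 xs                                   ∎
    where open ≡-Reasoning

  Dpow-F-odd : ∀ r {xs} → Partition nothing xs →
               Dpow (suc (2 ℕ.* r)) (F (suc r)) xs ≡ ℕ→ℚ (oddFact (suc r)) * down (F 0) xs
  Dpow-F-even : ∀ r {xs} → Partition nothing xs →
                Dpow (suc (suc (2 ℕ.* r))) (F (suc r)) xs ≡ ℕ→ℚ (oddFact (suc r)) * F 0 xs

  Dpow-F-odd zero {xs} π = trans (D-F-suc 0 π) (sym (ℚ.*-identityˡ (down (F 0) xs)))
  Dpow-F-odd (suc r) {xs} π = begin
    Dpow (suc (2 ℕ.* suc r)) (F (suc (suc r))) xs
      ≡⟨ cong (λ n → Dpow (suc n) (F (suc (suc r))) xs) (ℕ.*-suc 2 r) ⟩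
    Dpow (suc (suc (suc m))) (F (suc (suc r))) xs
      ≡⟨ cong (λ f → f xs) (Dpow-D (suc (suc m)) (F (suc (suc r)))) ⟨
    Dpow (suc (suc m)) (D (F (suc (suc r)))) xs
      ≡⟨ Dpow-cong (suc (suc m)) π (D-F-suc (suc r)) ⟩
    Dpow (suc (suc m)) (down (F (suc r))) xs
      ≡⟨ Dpow-down (suc m) (F (suc r)) π ⟩
    down (Dpow (suc (suc m)) (F (suc r))) xs + ℕ→ℚ (suc (suc m)) * Dpow (suc m) (F (suc r)) xs
      -- The even case supplies the coefficient 1 and the commutator 2r + 2; together they make 2r +
      -- 3, the next factor of the double factorial.
      ≡⟨ cong₂ (λ a b → a + ℕ→ℚ (suc (suc m)) * b) (trans (down-cong π (Dpow-F-even r)) (down-* c (F 0) xs)) (Dpow-F-odd r π) ⟩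
    c * down (F 0) xs + ℕ→ℚ (suc (suc m)) * (c * down (F 0) xs)
      ≡⟨ ℚSolver.solve 3 (λ c d k → c :* d :+ k :* (c :* d) := (:1 :+ k) :* c :* d) refl c (down (F 0) xs) (ℕ→ℚ (suc (suc m))) ⟩
    (1ℚ + ℕ→ℚ (suc (suc m))) * c * down (F 0) xs
      ≡⟨ cong (λ k → k * c * down (F 0) xs) (ℕ→ℚ-+ 1 (suc (suc m))) ⟨
    ℕ→ℚ (suc (suc (suc m))) * c * down (F 0) xs
      ≡⟨ cong (_* down (F 0) xs) (ℕ→ℚ-* (suc (suc (suc m))) (oddFact (suc r))) ⟨
    ℕ→ℚ (suc (suc (suc m)) ℕ.* oddFact (suc r)) * down (F 0) xs
      ≡⟨ cong (λ n → ℕ→ℚ (suc n ℕ.* oddFact (suc r)) * down (F 0) xs) (ℕ.*-suc 2 r) ⟨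
    ℕ→ℚ (oddFact (suc (suc r))) * down (F 0) xs ∎
    where
    open ≡-Reasoning
    open ℚSolver
    m = 2 ℕ.* r
    c = ℕ→ℚ (oddFact (suc r))

  Dpow-F-even r {xs} π = begin
    D (Dpow (suc (2 ℕ.* r)) (F (suc r))) xs                  ≡⟨ D-cong π (Dpow-F-odd r) ⟩
    D (λ ν → ℕ→ℚ (oddFact (suc r)) * down (F 0) ν) xs        ≡⟨ D-* (ℕ→ℚ (oddFact (suc r))) (down (F 0)) xs ⟩
    ℕ→ℚ (oddFact (suc r)) * D (down (F 0)) xs                ≡⟨ cong (ℕ→ℚ (oddFact (suc r)) *_) (D-down-F-zero π) ⟩
    ℕ→ℚ (oddFact (suc r)) * F 0 xs                           ∎
    where open ≡-Reasoning

  Dpow-F-vanish : ∀ r {xs} → Partition nothing xs → Dpow (suc (2 ℕ.* r)) (F r) xs ≡ 0ℚ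
  Dpow-F-vanish zero π = D-F-zero π
  Dpow-F-vanish (suc r) {xs} π = begin
    Dpow (suc (2 ℕ.* suc r)) (F (suc r)) xs                  ≡⟨ cong (λ n → Dpow (suc n) (F (suc r)) xs) (ℕ.*-suc 2 r) ⟩
    D (Dpow (suc (suc (2 ℕ.* r))) (F (suc r))) xs            ≡⟨ D-cong π (Dpow-F-even r) ⟩
    D (λ ν → ℕ→ℚ (oddFact (suc r)) * F 0 ν) xs               ≡⟨ D-* (ℕ→ℚ (oddFact (suc r))) (F 0) xs ⟩
    ℕ→ℚ (oddFact (suc r)) * D (F 0) xs                       ≡⟨ cong (ℕ→ℚ (oddFact (suc r)) *_) (D-F-zero π) ⟩
    ℕ→ℚ (oddFact (suc r)) * 0ℚ                               ≡⟨ ℚ.*-zeroʳ (ℕ→ℚ (oddFact (suc r))) ⟩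
    0ℚ                                                       ∎
    where open ≡-Reasoning

  linked-partition : ∀ p {x xs} → x ⊑ p → Linked ℕ._≥_ (x ∷ xs) → All (0 <_) (x ∷ xs) → Partition p (x ∷ xs)
  linked-partition p {suc x} x⊑p [-] (_ ∷ []) = x⊑p ∷ []
  linked-partition p {suc x} x⊑p (x≥y ∷ ys) (_ ∷ 0<ys) = x⊑p ∷ linked-partition (just (suc x)) x≥y ys 0<ys

  isPartition : ∀ {xs} → IsPartition xs → Partition nothing xs
  isPartition {[]} _ = []
  isPartition {x ∷ xs} (ys , 0<ys) = linked-partition nothing tt ys 0<ys

open Differences
open import Data.Nat using (_*_)
open import Data.Rational using () renaming (_*_ to _*ℚ_)

theorem5p2 : (μ : List ℕ) → IsPartition μ →
    ((r : ℕ) → Dpow (suc (2 * r)) (F r) μ ≡ 0ℚ)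
    × ((r : ℕ) → 1 ≤ r → Dpow (2 * r) (F r) μ ≡ ℕ→ℚ (oddFact r) *ℚ inv (H μ))
    × ((r : ℕ) → 1 ≤ r → Dpow (2 * r ∸ 1) (F r) μ
    ≡ ℕ→ℚ (oddFact r) *ℚ inv (H μ) *ℚ ℕ→ℚ (size μ))
theorem5p2 μ μ-partition = (λ r → Dpow-F-vanish r π) , even , odd
  where
  open ≡ using (trans; cong; sym)
  π = isPartition μ-partition
  even : (r : ℕ) → 1 ≤ r → Dpow (2 * r) (F r) μ ≡ ℕ→ℚ (oddFact r) *ℚ inv (H μ)
  even (suc r) _ = trans (cong (λ n → Dpow n (F (suc r)) μ) (ℕ.*-suc 2 r))
    (trans (Dpow-F-even r π) (cong (ℕ→ℚ (oddFact (suc r)) *ℚ_) (F-zero μ)))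
  odd : (r : ℕ) → 1 ≤ r → Dpow (2 * r ∸ 1) (F r) μ ≡ ℕ→ℚ (oddFact r) *ℚ inv (H μ) *ℚ ℕ→ℚ (size μ)
  odd (suc r) _ = trans (cong (λ n → Dpow (n ∸ 1) (F (suc r)) μ) (ℕ.*-suc 2 r))
    (trans (Dpow-F-odd r π) (trans (cong (ℕ→ℚ (oddFact (suc r)) *ℚ_) (down-F-zero π))
      (sym (ℚ.*-assoc (ℕ→ℚ (oddFact (suc r))) (inv (H μ)) (ℕ→ℚ (size μ))))))
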